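{- There exists a polynomial-time (many-one) reduction from the decision problem ForcingGPM to the decision problem Anti-ForcingGPM.
   Context: Graphs $G=(V(G),E(G))$ are finite, and edges are unordered pairs $\{u,v\}$ of distinct vertices. A perfect matching of $G$ is a set $M\subseteq E(G)$ such that every vertex is incident to exactly one edge of $M$. For a perfect matching $M$ of $G$, a forcing set of $M$ is an edge set $F\subseteq M$ such that no perfect matching of $G$ other than $M$ contains $F$; an anti-forcing set of $M$ is an edge set $A\subseteq E(G)\setminus M$ such that the graph $(V(G),E(G)\setminus A)$ has $M$ as its only perfect matching. ForcingGPM: given a graph $G$, a perfect matching $M$ of $G$, and a nonnegative integer $k$, decide whether there exists a forcing set of $M$ of size at most $k$. Anti-ForcingGPM: given a graph $G$, a perfect matching $M$ of $G$, and a nonnegative integer $k$, decide whether there exists an anti-forcing set of $M$ of size at most $k$. -}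

module Defs where

open import Data.Bool.Base using (Bool; true; false; T; not; _∧_)
open import Data.Fin.Base using (Fin; toℕ)
open import Data.List.Base
  using (List; []; _∷_; _++_; map; length; filterᵇ; allFin; cartesianProduct; replicate)
open import Data.Maybe.Base using (Maybe; just; nothing)
open import Data.Nat.Base using (ℕ; suc; _+_; _*_; _^_; _≤_; _<ᵇ_)
open import Data.Nat.Binary.Base using (ℕᵇ; zero; 2[1+_]; 1+[2_]; fromℕ)
open import Data.Product using (Σ-syntax; ∃-syntax; ∃!; _×_; _,_; uncurry)
open import Data.Vec.Base as Vec using (Vec; lookup; zipWith; _[_]≔_)
open import Function.Bundles using (_⇔_; _↔_)
open import Relation.Binary.PropositionalEquality using (_≡_; _≢_; cong; cong₂)

------------------------------------------------------------------------
-- Graphs and matchings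

-- A set of unordered pairs {u,v} of distinct vertices, given by its
-- adjacency relation.  A graph is a number n of vertices together with an
-- EdgeSet n.

record EdgeSet (n : ℕ) : Set where
  field
    adj        : Fin n → Fin n → Bool
    adj-sym    : ∀ u v → adj u v ≡ adj v u
    adj-irrefl : ∀ v → adj v v ≡ false

open EdgeSet public

infix 4 _⟨_,_⟩ _⊆_ _≐_

_⟨_,_⟩ : ∀ {n} → EdgeSet n → Fin n → Fin n → Set
E ⟨ u , v ⟩ = T (adj E u v)

_⊆_ : ∀ {n} → EdgeSet n → EdgeSet n → Set
E ⊆ F = ∀ u v → E ⟨ u , v ⟩ → F ⟨ u , v ⟩

_≐_ : ∀ {n} → EdgeSet n → EdgeSet n → Set
E ≐ F = ∀ u v → adj E u v ≡ adj F u v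

infixl 6 _∖_

_∖_ : ∀ {n} → EdgeSet n → EdgeSet n → EdgeSet n
adj        (E ∖ A) u v = adj E u v ∧ not (adj A u v)
adj-sym    (E ∖ A) u v = cong₂ (λ x y → x ∧ not y) (adj-sym E u v) (adj-sym A u v)
adj-irrefl (E ∖ A) v   = cong (λ x → x ∧ not (adj A v v)) (adj-irrefl E v)

pairs : ∀ n → List (Fin n × Fin n)
pairs n = cartesianProduct (allFin n) (allFin n)

-- Each edge is counted once, at its pair (u , v) with u < v.

size : ∀ {n} → EdgeSet n → ℕ
size {n} E = length (filterᵇ (λ (u , v) → (toℕ u <ᵇ toℕ v) ∧ adj E u v) (pairs n))

PerfectMatching : ∀ {n} → EdgeSet n → EdgeSet n → Set
PerfectMatching E M = M ⊆ E × (∀ u → ∃! _≡_ λ v → M ⟨ u , v ⟩)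

ForcingSet : ∀ {n} → (E M F : EdgeSet n) → Set
ForcingSet E M F = F ⊆ M × (∀ N → PerfectMatching E N → F ⊆ N → N ≐ M)

AntiForcingSet : ∀ {n} → (E M A : EdgeSet n) → Set
AntiForcingSet E M A =
  A ⊆ E ∖ M × PerfectMatching (E ∖ A) M × (∀ N → PerfectMatching (E ∖ A) N → N ≐ M)

------------------------------------------------------------------------
-- Deterministic multi-tape Turing machines

-- A two-way infinite tape.  `left` lists the cells to the left of the head,
-- nearest first; all cells beyond the ends of the two lists are blank.

record Tape (Γ : Set) : Set where
  constructor tape
  field
    left  : List Γ
    head  : Γ
    right : List Γ

data Move : Set where
  L S R : Move

record TM : Set₁ where
  field
    tapes           : ℕ
    State           : Set
    Symbol          : Set
    finite-State    : ∃[ n ] (State ↔ Fin n)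
    finite-Symbol   : ∃[ n ] (Symbol ↔ Fin n)
    blank           : Symbol
    bit             : Bool → Symbol
    bit-injective   : ∀ {a b} → bit a ≡ bit b → a ≡ b
    bit≢blank       : ∀ b → bit b ≢ blank
    start           : State
    inTape outTape  : Fin tapes
    -- The machine halts when δ yields `nothing`.
    δ               : State → Vec Symbol tapes → Maybe (State × Vec (Symbol × Move) tapes)

module Run (T : TM) where
  open TM T
  open Tape

  Config : Set
  Config = State × Vec (Tape Symbol) tapes

  move : Move → Tape Symbol → Tape Symbol
  move S t                     = t
  move L (tape []       a rs)  = tape [] blank (a ∷ rs)
  move L (tape (l ∷ ls) a rs)  = tape ls l (a ∷ rs)
  move R (tape ls a [])        = tape (a ∷ ls) blank []
  move R (tape ls a (r ∷ rs))  = tape (a ∷ ls) r rs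

  act : Symbol × Move → Tape Symbol → Tape Symbol
  act (a , m) (tape ls _ rs) = move m (tape ls a rs)

  step : Config → Maybe Config
  step (q , ts) with δ q (Vec.map head ts)
  ... | nothing        = nothing
  ... | just (q′ , as) = just (q′ , zipWith act as ts)

  -- c ⇓[ t ] d : started in c, the machine halts in d after exactly t steps.

  infix 4 _⇓[_]_

  data _⇓[_]_ : Config → ℕ → Config → Set where
    halt : ∀ {c} → step c ≡ nothing → c ⇓[ 0 ] c
    next : ∀ {c c′ d t} → step c ≡ just c′ → c′ ⇓[ t ] d → c ⇓[ suc t ] d

  load : List Bool → Tape Symbol
  load []       = tape [] blank []
  load (b ∷ bs) = tape [] (bit b) (map bit bs)

  initial : List Bool → Config
  initial w = start , Vec.replicate tapes (load []) [ inTape ]≔ load w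

  -- The output tape contains w and otherwise only blanks, with the head on
  -- the first cell of w.

  Outputs : Config → List Bool → Set
  Outputs (_ , ts) w =
    (∃[ i ] left t ≡ replicate i blank) ×
    (∃[ j ] head t ∷ right t ≡ map bit w ++ replicate j blank)
    where t = lookup ts outTape

------------------------------------------------------------------------
-- Decision problems and polynomial-time many-one reductions

record DecisionProblem : Set₁ where
  field
    Instance : Set
    encode   : Instance → List Bool
    Yes      : Instance → Set

PolyTime : ∀ {I J : Set} → (I → List Bool) → (J → List Bool) → (I → J) → Set₁
PolyTime encI encJ f =
  Σ[ M ∈ TM ] ∃[ c ] ∃[ d ] (∀ x → let open Run M in
    ∃[ t ] ∃[ final ]
      (initial (encI x) ⇓[ t ] final) ×
      (t ≤ c * length (encI x) ^ d + c) ×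
      Outputs final (encJ (f x)))

infix 4 _≤ₚ_

_≤ₚ_ : DecisionProblem → DecisionProblem → Set₁
P ≤ₚ Q = Σ[ f ∈ (P.Instance → Q.Instance) ]
  PolyTime P.encode Q.encode f × (∀ x → P.Yes x ⇔ Q.Yes (f x))
  where
  module P = DecisionProblem P
  module Q = DecisionProblem Q

------------------------------------------------------------------------
-- The two problems

record MatchingInstance : Set where
  field
    {n}     : ℕ
    G       : EdgeSet n
    M       : EdgeSet n
    perfect : PerfectMatching G M
    k       : ℕ

-- Bijective base-2 numerals, least significant digit first (digit 2 is true,
-- digit 1 is false): every bit string denotes exactly one number.

bits : ℕᵇ → List Bool
bits zero     = []
bits 2[1+ b ] = true ∷ bits b
bits 1+[2 b ] = false ∷ bits b

-- 1ⁿ0, the two n × n adjacency matrices row by row, then k in binary.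
-- The first part delimits the rest, so the code is uniquely decodable.

encodeInstance : MatchingInstance → List Bool
encodeInstance I =
  replicate n true ++ false ∷ matrix G ++ matrix M ++ bits (fromℕ k)
  where
  open MatchingInstance I
  matrix : EdgeSet n → List Bool
  matrix E = map (uncurry (adj E)) (pairs n)

ForcingGPM : DecisionProblem
ForcingGPM = record
  { Instance = MatchingInstance
  ; encode   = encodeInstance
  ; Yes      = λ I → let open MatchingInstance I in
                 ∃[ F ] ForcingSet G M F × size F ≤ k
  }

Anti-ForcingGPM : DecisionProblem
Anti-ForcingGPM = record
  { Instance = MatchingInstance
  ; encode   = encodeInstance
  ; Yes      = λ I → let open MatchingInstance I in
                 ∃[ A ] AntiForcingSet G M A × size A ≤ k
  }

{-# OPTIONS --safe #-}
module Submission where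

-- Subdivide every matching edge uv of G into a path u u′ v′ v whose end edges
-- uu′ and vv′ are the matching edges of the new graph G′.  Alternating cycles
-- correspond, and G′ has adjacency matrix [[G∖M, I], [I, M]] with perfect
-- matching [[0, I], [I, 0]].  Deleting u′v′ in G′ amounts to forcing uv in G.
-- Conversely an anti-forcing set may be charged edge by edge to matching
-- edges: u′v′ to uv, and a deleted edge xy of G∖M to the matching edge at its
-- smaller end x, since fixing that edge already excludes xy.  The parameter k
-- does not change, and the matrices of G′ are written row by row by a machine
-- running in time linear in the length of the code.

open import Defs
open import Data.Bool.Base using (Bool; true; false; not; _∧_; _∨_; T; if_then_else_)
open import Data.Bool.Properties using (T-∧; T-∨; T?; ∧-comm)
open import Data.Empty using (⊥-elim)
open import Data.Fin.Base using (Fin; zero; suc; toℕ; _↑ˡ_; _↑ʳ_; splitAt; join)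
open import Data.Fin.Patterns using (0F; 1F; 2F; 3F; 4F)
open import Data.Fin.Properties
  using (_≟_; any?; toℕ-↑ˡ; toℕ-↑ʳ; toℕ-injective; splitAt-join; join-splitAt; 2↔Bool; +↔⊎; *↔×)
open import Data.List.Base
  using (List; []; _∷_; _++_; _ʳ++_; map; length; reverse; replicate; filterᵇ; allFin; tabulate; cartesianProduct)
open import Data.List.Membership.Propositional using (_∈_)
open import Data.List.Membership.Propositional.Properties
  using (∈-∃++; ∈-++⁻; ∈-++⁺ˡ; ∈-++⁺ʳ; ∈-map⁺; ∈-filter⁺; ∈-filter⁻; ∈-cartesianProduct⁺; ∈-allFin)
open import Data.List.Properties
  using (++-assoc; ++-identityʳ; ++-ʳ++; ʳ++-defn; ʳ++-ʳ++; reverse-map; map-++; map-cong; map-id; map-∘; map-replicate;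
         map-tabulate; length-++; length-map; length-replicate; length-reverse; length-tabulate;
         cartesianProductWith-distribʳ-++)
open import Data.List.Relation.Unary.All as All using ()
open import Data.List.Relation.Unary.AllPairs using ([]; _∷_)
open import Data.List.Relation.Unary.Any using (here; there)
open import Data.List.Relation.Unary.Unique.Propositional using (Unique)
import Data.List.Relation.Unary.Unique.Propositional.Properties as Unique
open import Data.Maybe.Base using (Maybe; just; nothing; fromMaybe)
open import Data.Nat.Base using (ℕ; zero; suc; _+_; _*_; _^_; _≤_; _<_; _<ᵇ_; z≤n; s≤s)
open import Data.Nat.Binary.Base using (fromℕ)
open import Data.Nat.Properties
  using (+-assoc; +-comm; +-suc; m≤m+n; ≤-trans; ≤-reflexive; <ᵇ⇒<; <⇒<ᵇ; <-cmp; <-asym; _<?_; +-cancelˡ-<; module ≤-Reasoning)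
open import Data.Nat.Tactic.RingSolver using (solve-∀)
open import Data.Product using (_×_; _,_; proj₁; proj₂; ∃-syntax; ∃₂; ∃!; Σ-syntax; uncurry)
open import Data.Product.Function.NonDependent.Propositional using (_×-↔_)
open import Data.Sum.Base using (_⊎_; inj₁; inj₂; swap; [_,_]′)
open import Data.Sum.Function.Propositional using (_⊎-↔_)
open import Data.Sum.Properties using (inj₁-injective)
open import Data.Vec.Base using (Vec; []; _∷_)
open import Function.Base using (const; id)
open import Function.Bundles using (Equivalence; _⇔_; mk⇔; _↔_; mk↔ₛ′)
open import Function.Construct.Composition using (_↔-∘_)
open import Function.Construct.Identity using (↔-id)
open import Function.Construct.Symmetry using (↔-sym)
open import Relation.Binary.Definitions using (tri<; tri≈; tri>)
open import Relation.Binary.PropositionalEquality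
open import Relation.Nullary using (¬_; Dec; yes; no; contradiction)
open import Relation.Nullary.Decidable using (does; ⌊_⌋; toWitness; fromWitness; _×-dec_; _⊎-dec_)

-- No alternating cycle is ever handled: perfect matchings are translated as wholes. A matching `N`
-- of `G` corresponds to the matching of `G′` that keeps `N ∖ M`, takes both rungs uu′ and vv′ when
-- uv lies in `N` and `M`, and takes u′v′ when uv lies in `M ∖ N`. Since u′ has only the neighbours
-- u and v′, losing u′v′ forces the rung at u, which is to say that uv is forced. Charging a deleted
-- edge at one end only is essential: xy meets two matching edges, and charging both could double
-- the size of the set. The smaller end is the convenient choice because `size` lists an edge from
-- that end. For the machine the obstacle is addressing: it has no counters for rows and columns.
-- The unit vector on the ruler replaces them all. Its length delimits a row, its contents are the
-- current row of the identity matrix, and the 1 falling off its end signals the last row.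

∧⁺ : ∀ {x y} → T x → T y → T (x ∧ y)
∧⁺ p q = Equivalence.from T-∧ (p , q)

∧⁻ : ∀ {x y} → T (x ∧ y) → T x × T y
∧⁻ = Equivalence.to T-∧

not⁺ : ∀ {x} → ¬ T x → T (not x)
not⁺ {false} _ = _
not⁺ {true}  ¬t = ¬t _

not⁻ : ∀ {x} → T (not x) → ¬ T x
not⁻ {false} _ ()

T-ext : ∀ {x y} → (T x → T y) → (T y → T x) → x ≡ y
T-ext {false} {false} _ _ = refl
T-ext {false} {true}  _ g = ⊥-elim (g _)
T-ext {true}  {false} f _ = ⊥-elim (f _)
T-ext {true}  {true}  _ _ = refl

same : ∀ {n} → Fin n → Fin n → Bool
same i j = does (i ≟ j)

same⁻ : ∀ {n} {u v : Fin n} → T (same u v) → u ≡ v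
same⁻ {u = u} {v} t with u ≟ v
... | yes eq = eq

same⁺ : ∀ {n} (u : Fin n) → T (same u u)
same⁺ u with u ≟ u
... | yes _ = _
... | no u≢u = u≢u refl

length-Unique-⊆ : ∀ {A : Set} {xs ys : List A} → Unique xs → (∀ {x} → x ∈ xs → x ∈ ys) → length xs ≤ length ys
length-Unique-⊆ [] _ = z≤n
length-Unique-⊆ {xs = x ∷ xs} (x∉xs ∷ uniq) xs⊆ys with ∈-∃++ (xs⊆ys (here refl))
... | as , bs , refl = begin
  suc (length xs)                ≤⟨ s≤s (length-Unique-⊆ uniq smaller) ⟩
  suc (length (as ++ bs))        ≡⟨ cong suc (length-++ as) ⟩
  suc (length as + length bs)    ≡⟨ +-suc (length as) (length bs) ⟨
  length as + suc (length bs)    ≡⟨ length-++ as ⟨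
  length (as ++ x ∷ bs)          ∎
  where
  open ≤-Reasoning
  smaller : ∀ {y} → y ∈ xs → y ∈ as ++ bs
  smaller y∈xs with ∈-++⁻ as (xs⊆ys (there y∈xs))
  ... | inj₁ y∈as         = ∈-++⁺ˡ y∈as
  ... | inj₂ (here refl)  = ⊥-elim (All.lookup x∉xs y∈xs refl)
  ... | inj₂ (there y∈bs) = ∈-++⁺ʳ as y∈bs

-- Sizes are compared through a covering map rather than an injection, which is the shape of a
-- charging argument. Values of `h` outside the covered pairs do not matter, and only increasing
-- pairs occur because each edge is counted once.
size-≤ : ∀ {m n} (E : EdgeSet m) (E′ : EdgeSet n) (h : Fin n × Fin n → Fin m × Fin m) →
  (∀ u v → toℕ u < toℕ v → E ⟨ u , v ⟩ → ∃₂ λ p q → toℕ p < toℕ q × E′ ⟨ p , q ⟩ × h (p , q) ≡ (u , v)) →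
  size E ≤ size E′
size-≤ {m} {n} E E′ h cover =
  ≤-trans (length-Unique-⊆ unique covered) (≤-reflexive (length-map h (edges E′)))
  where
  edges : ∀ {k} → EdgeSet k → List (Fin k × Fin k)
  edges {k} D = filterᵇ (λ (u , v) → (toℕ u <ᵇ toℕ v) ∧ adj D u v) (pairs k)
  unique = Unique.filter⁺ _ (Unique.cartesianProduct⁺ (Unique.allFin⁺ m) (Unique.allFin⁺ m))
  covered : ∀ {x} → x ∈ edges E → x ∈ map h (edges E′)
  covered {u , v} x∈
    with (u<v , Euv) ← ∧⁻ (proj₂ (∈-filter⁻ _ {xs = pairs m} x∈))
    with p , q , p<q , E′pq , eq ← cover u v (<ᵇ⇒< (toℕ u) (toℕ v) u<v) Euv
    = subst (_∈ _) eq (∈-map⁺ h (∈-filter⁺ _ (∈-cartesianProduct⁺ (∈-allFin p) (∈-allFin q))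
        (∧⁺ {toℕ p <ᵇ toℕ q} (<⇒<ᵇ p<q) E′pq)))

-- Partners in perfect matchings

Matched : ∀ {n} → EdgeSet n → Set
Matched M = ∀ u → ∃! _≡_ λ v → M ⟨ u , v ⟩

symmetric : ∀ {n} (E : EdgeSet n) {u v} → E ⟨ u , v ⟩ → E ⟨ v , u ⟩
symmetric E {u} {v} = subst T (adj-sym E u v)

irreflexive : ∀ {n} (E : EdgeSet n) {u} → ¬ E ⟨ u , u ⟩
irreflexive E {u} t = subst T (adj-irrefl E u) t

partner-unique : ∀ {n} {M : EdgeSet n} → Matched M → ∀ {u v w} → M ⟨ u , v ⟩ → M ⟨ u , w ⟩ → v ≡ w
partner-unique matched {u} p q = let (_ , _ , unique) = matched u in trans (sym (unique p)) (unique q)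

-- Each vertex already has its `M`-partner within `N`, and `N` leaves room for no other. Uniqueness
-- of a matching thus reduces to a single inclusion.
matched-⊆⇒≐ : ∀ {n} {M N : EdgeSet n} → Matched M → Matched N → M ⊆ N → N ≐ M
matched-⊆⇒≐ {M = M} {N} mM mN M⊆N u v = T-ext N→M (M⊆N u v)
  where
  N→M : N ⟨ u , v ⟩ → M ⟨ u , v ⟩
  N→M Nuv = let (w , Muw , _) = mM u in
    subst (λ z → M ⟨ u , z ⟩) (partner-unique {M = N} mN (M⊆N u w Muw) Nuv) Muw

∅ : ∀ {n} → EdgeSet n
adj        ∅ _ _ = false
adj-sym    ∅ _ _ = refl
adj-irrefl ∅ _   = refl

-- Graphs on two copies of the vertex set

module _ {n : ℕ} where

  adj⊎ : EdgeSet n → (Fin n → Bool) → EdgeSet n → (s t : Fin n ⊎ Fin n) → Bool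
  adj⊎ A d B (inj₁ u) (inj₁ v) = adj A u v
  adj⊎ A d B (inj₁ u) (inj₂ v) = d u ∧ same u v
  adj⊎ A d B (inj₂ u) (inj₁ v) = d u ∧ same u v
  adj⊎ A d B (inj₂ u) (inj₂ v) = adj B u v

  rung-sym : ∀ (d : Fin n → Bool) u v → d u ∧ same u v ≡ d v ∧ same v u
  rung-sym d u v = T-ext (flip u v) (flip v u)
    where
    flip : ∀ u v → T (d u ∧ same u v) → T (d v ∧ same v u)
    flip u v t with (du , eq) ← ∧⁻ {d u} t with refl ← same⁻ {u = u} eq = t

  adj⊎-sym : ∀ A d B s t → adj⊎ A d B s t ≡ adj⊎ A d B t s
  adj⊎-sym A d B (inj₁ u) (inj₁ v) = adj-sym A u v
  adj⊎-sym A d B (inj₁ u) (inj₂ v) = rung-sym d u v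
  adj⊎-sym A d B (inj₂ u) (inj₁ v) = rung-sym d u v
  adj⊎-sym A d B (inj₂ u) (inj₂ v) = adj-sym B u v

  adj⊎-irrefl : ∀ A d B s → adj⊎ A d B s s ≡ false
  adj⊎-irrefl A d B (inj₁ u) = adj-irrefl A u
  adj⊎-irrefl A d B (inj₂ u) = adj-irrefl B u

  -- The original vertex u is inj₁ u and its copy u′ is inj₂ u; d tells which
  -- edges uu′ are present.
  double : EdgeSet n → (Fin n → Bool) → EdgeSet n → EdgeSet (n + n)
  adj        (double A d B) p q = adj⊎ A d B (splitAt n p) (splitAt n q)
  adj-sym    (double A d B) p q = adj⊎-sym A d B (splitAt n p) (splitAt n q)
  adj-irrefl (double A d B) p   = adj⊎-irrefl A d B (splitAt n p)

  vertex : Fin n ⊎ Fin n → Fin (n + n)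
  vertex = join n n

  adj-double : ∀ {A d B} s t → adj (double A d B) (vertex s) (vertex t) ≡ adj⊎ A d B s t
  adj-double {A} {d} {B} s t = cong₂ (adj⊎ A d B) (splitAt-join n n s) (splitAt-join n n t)

  double⁺ : ∀ {A d B} s t → T (adj⊎ A d B s t) → double A d B ⟨ vertex s , vertex t ⟩
  double⁺ {A} {d} {B} s t = subst T (sym (adj-double {A} {d} {B} s t))

  double⁻ : ∀ {A d B} s t → double A d B ⟨ vertex s , vertex t ⟩ → T (adj⊎ A d B s t)
  double⁻ {A} {d} {B} s t = subst T (adj-double {A} {d} {B} s t)

  -- `splitAt` does not reduce on a variable vertex. Passing to `vertex s` allows case distinction
  -- on the constructors of `s`, where `adj⊎` computes.
  by-vertex : (P : Fin (n + n) → Set) → (∀ s → P (vertex s)) → ∀ p → P p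
  by-vertex P f p = subst P (join-splitAt n n p) (f (splitAt n p))

  ⊆-by-vertex : ∀ {E E′ : EdgeSet (n + n)} →
    (∀ s t → E ⟨ vertex s , vertex t ⟩ → E′ ⟨ vertex s , vertex t ⟩) → E ⊆ E′
  ⊆-by-vertex {E} {E′} f =
    by-vertex (λ p → ∀ q → E ⟨ p , q ⟩ → E′ ⟨ p , q ⟩) λ s →
    by-vertex (λ q → E ⟨ vertex s , q ⟩ → E′ ⟨ vertex s , q ⟩) (f s)

  matched-by-vertex : ∀ {E : EdgeSet (n + n)} →
    (∀ s → ∃[ t ] E ⟨ vertex s , vertex t ⟩ × (∀ t′ → E ⟨ vertex s , vertex t′ ⟩ → t ≡ t′)) → Matched E
  matched-by-vertex {E} f = by-vertex (λ p → ∃! _≡_ λ q → E ⟨ p , q ⟩) λ s →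
    let (t , Est , unique) = f s in
    vertex t , Est , λ {q} →
      by-vertex (λ q → E ⟨ vertex s , q ⟩ → vertex t ≡ q) (λ t′ Est′ → cong vertex (unique t′ Est′)) q

  matched-at : ∀ {E : EdgeSet (n + n)} → Matched E → ∀ s → ∃[ t ] E ⟨ vertex s , vertex t ⟩
  matched-at {E} m s = let (q , Esq , _) = m (vertex s) in
    splitAt n q , subst (λ z → E ⟨ vertex s , z ⟩) (sym (join-splitAt n n q)) Esq

  vertex-injective : ∀ {s t} → vertex s ≡ vertex t → s ≡ t
  vertex-injective {s} {t} eq =
    trans (sym (splitAt-join n n s)) (trans (cong (splitAt n) eq) (splitAt-join n n t))

  rungs : EdgeSet (n + n)
  rungs = double ∅ (const true) ∅

  rungs⁻ : ∀ s t → rungs ⟨ vertex s , vertex t ⟩ → swap s ≡ t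
  rungs⁻ s t e with s | t | double⁻ {∅} {const true} {∅} s t e
  ... | inj₁ u | inj₂ v | eq = cong inj₂ (same⁻ eq)
  ... | inj₂ u | inj₁ v | eq = cong inj₁ (same⁻ eq)

  rungs⁺ : ∀ s → rungs ⟨ vertex s , vertex (swap s) ⟩
  rungs⁺ s = double⁺ s (swap s) (lemma s)
    where
    lemma : ∀ s → T (adj⊎ ∅ (const true) ∅ s (swap s))
    lemma (inj₁ u) = same⁺ u
    lemma (inj₂ u) = same⁺ u

  rungs-matched : Matched rungs
  rungs-matched = matched-by-vertex {E = rungs} λ s → swap s , rungs⁺ s , rungs⁻ s

∖⁺ : ∀ {n} (E A : EdgeSet n) {u v} → E ⟨ u , v ⟩ → ¬ A ⟨ u , v ⟩ → (E ∖ A) ⟨ u , v ⟩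
∖⁺ E A e ¬a = ∧⁺ e (not⁺ ¬a)

∖⁻ : ∀ {n} (E A : EdgeSet n) {u v} → (E ∖ A) ⟨ u , v ⟩ → E ⟨ u , v ⟩ × ¬ A ⟨ u , v ⟩
∖⁻ E A {u} {v} t = let (e , ¬a) = ∧⁻ {adj E u v} t in e , not⁻ ¬a

-- Correctness of the reduction

module Reduction {n : ℕ} (G M : EdgeSet n) (perfect : PerfectMatching G M) where

  mate : Fin n → Fin n
  mate u = proj₁ (proj₂ perfect u)

  mate-edge : ∀ u → M ⟨ u , mate u ⟩
  mate-edge u = proj₁ (proj₂ (proj₂ perfect u))

  mate-unique : ∀ {u v} → M ⟨ u , v ⟩ → mate u ≡ v
  mate-unique {u} = proj₂ (proj₂ (proj₂ perfect u))

  G′ : EdgeSet (n + n)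
  G′ = double (G ∖ M) (const true) M

  M′ : EdgeSet (n + n)
  M′ = rungs {n}

  M′-matched : Matched M′
  M′-matched = rungs-matched {n}

  M′⊆G′ : M′ ⊆ G′
  M′⊆G′ = ⊆-by-vertex {E = M′} {G′} λ s t e → double⁺ {A = G ∖ M} {B = M} s t (lemma s t (double⁻ {A = ∅} {B = ∅} s t e))
    where
    lemma : ∀ s t → T (adj⊎ ∅ (const true) ∅ s t) → T (adj⊎ (G ∖ M) (const true) M s t)
    lemma (inj₁ u) (inj₂ v) e = e
    lemma (inj₂ u) (inj₁ v) e = e

  M′-perfect : PerfectMatching G′ M′
  M′-perfect = M′⊆G′ , M′-matched

  -- From forcing sets to anti-forcing sets

  module Forward (F : EdgeSet n) (forcing : ForcingSet G M F) where

    F⊆M = proj₁ forcing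

    A : EdgeSet (n + n)
    A = double ∅ (const false) F

    A⁻ : ∀ s t → A ⟨ vertex s , vertex t ⟩ → ∃₂ λ u v → s ≡ inj₂ u × t ≡ inj₂ v × F ⟨ u , v ⟩
    A⁻ s t e with s | t | double⁻ {A = ∅} {const false} {F} s t e
    ... | inj₁ _ | inj₁ _ | ()
    ... | inj₁ _ | inj₂ _ | ()
    ... | inj₂ _ | inj₁ _ | ()
    ... | inj₂ u | inj₂ v | f = u , v , refl , refl , f

    A⊆ : A ⊆ G′ ∖ M′
    A⊆ = ⊆-by-vertex {E = A} {G′ ∖ M′} λ s t e → lemma s t (A⁻ s t e)
      where
      lemma : ∀ s t → ∃₂ (λ u v → s ≡ inj₂ u × t ≡ inj₂ v × F ⟨ u , v ⟩) → (G′ ∖ M′) ⟨ vertex s , vertex t ⟩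
      lemma _ _ (u , v , refl , refl , f) =
        ∖⁺ G′ M′ (double⁺ {A = G ∖ M} {B = M} (inj₂ u) (inj₂ v) (F⊆M u v f))
          (λ r → contradiction (rungs⁻ (inj₂ u) (inj₂ v) r) λ ())

    M′-perfect-A : PerfectMatching (G′ ∖ A) M′
    M′-perfect-A = (λ p q r → ∖⁺ G′ A (M′⊆G′ p q r) (λ a → proj₂ (∖⁻ G′ M′ (A⊆ p q a)) r)) , M′-matched

    size-A : size A ≤ size F
    size-A = size-≤ A F (λ (u , v) → vertex (inj₂ u) , vertex (inj₂ v))
      (by-vertex (λ p → ∀ q → toℕ p < toℕ q → A ⟨ p , q ⟩ → _) λ s →
       by-vertex (λ q → toℕ (vertex s) < toℕ q → A ⟨ vertex s , q ⟩ → _) λ t s<t e → lemma s t (A⁻ s t e) s<t)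
      where
      lemma : ∀ s t → ∃₂ (λ u v → s ≡ inj₂ u × t ≡ inj₂ v × F ⟨ u , v ⟩) → toℕ (vertex s) < toℕ (vertex t) →
        ∃₂ λ u v → toℕ u < toℕ v × F ⟨ u , v ⟩ × (vertex (inj₂ u) , vertex (inj₂ v)) ≡ (vertex s , vertex t)
      lemma _ _ (u , v , refl , refl , f) s<t =
        u , v , +-cancelˡ-< n _ _ (subst₂ _<_ (toℕ-↑ʳ n u) (toℕ-↑ʳ n v) s<t) , f , refl

    module _ (N′ : EdgeSet (n + n)) (perfect′ : PerfectMatching (G′ ∖ A) N′) where

      N′-matched = proj₂ perfect′

      G′-edge : ∀ s t → N′ ⟨ vertex s , vertex t ⟩ → T (adj⊎ (G ∖ M) (const true) M s t)
      G′-edge s t e = double⁻ {A = G ∖ M} {B = M} s t (proj₁ (∖⁻ G′ A (proj₁ perfect′ _ _ e)))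

      unique′ : ∀ {s t t′ : Fin n ⊎ Fin n} → N′ ⟨ vertex s , vertex t ⟩ → N′ ⟨ vertex s , vertex t′ ⟩ → t ≡ t′
      unique′ e e′ = vertex-injective (partner-unique {M = N′} N′-matched e e′)

      rung : Fin n → Bool
      rung u = adj N′ (vertex (inj₁ u)) (vertex (inj₂ u))

      -- For uv ∈ M the two rungs are present together (rung-mate); asking for
      -- both makes N symmetric by construction.
      N : EdgeSet n
      adj        N u v = adj N′ (vertex (inj₁ u)) (vertex (inj₁ v)) ∨ adj M u v ∧ (rung u ∧ rung v)
      adj-sym    N u v = cong₂ _∨_ (adj-sym N′ _ _) (cong₂ _∧_ (adj-sym M u v) (∧-comm (rung u) (rung v)))
      adj-irrefl N u   rewrite adj-irrefl N′ (vertex (inj₁ u)) | adj-irrefl M u = refl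

      N⁻ : ∀ {u v} → N ⟨ u , v ⟩ → N′ ⟨ vertex (inj₁ u) , vertex (inj₁ v) ⟩ ⊎ M ⟨ u , v ⟩ × T (rung u)
      N⁻ {u} {v} e with Equivalence.to (T-∨ {adj N′ (vertex (inj₁ u)) (vertex (inj₁ v))}) e
      ... | inj₁ e′ = inj₁ e′
      ... | inj₂ e′ = let (m , r) = ∧⁻ {adj M u v} e′ in inj₂ (m , proj₁ (∧⁻ {rung u} r))

      N-old : ∀ {u v} → N′ ⟨ vertex (inj₁ u) , vertex (inj₁ v) ⟩ → N ⟨ u , v ⟩
      N-old e = Equivalence.from T-∨ (inj₁ e)

      -- The only neighbours of v′ are v and u′, and u′ is already taken by the rung at u.
      rung-mate : ∀ {u v} → M ⟨ u , v ⟩ → T (rung u) → T (rung v)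
      rung-mate {u} {v} m ru with matched-at {E = N′} N′-matched (inj₂ v)
      ... | inj₁ w , e with refl ← same⁻ {u = v} {w} (G′-edge (inj₂ v) (inj₁ w) e) = symmetric N′ e
      ... | inj₂ w , e with refl ← partner-unique {M = M} (proj₂ perfect) (G′-edge (inj₂ v) (inj₂ w) e) (symmetric M m)
          with () ← unique′ {inj₂ u} {inj₁ u} {inj₂ v} (symmetric N′ ru) (symmetric N′ e)

      N-new : ∀ {u v} → M ⟨ u , v ⟩ → T (rung u) → N ⟨ u , v ⟩
      N-new {u} {v} m ru = Equivalence.from (T-∨ {adj N′ (vertex (inj₁ u)) (vertex (inj₁ v))})
        (inj₂ (∧⁺ m (∧⁺ ru (rung-mate m ru))))

      N-perfect : PerfectMatching G N
      N-perfect = N⊆G , N-matched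
        where
        N⊆G : N ⊆ G
        N⊆G u v e with N⁻ e
        ... | inj₁ e′ = proj₁ (∖⁻ G M (G′-edge (inj₁ u) (inj₁ v) e′))
        ... | inj₂ (m , _) = proj₁ perfect u v m
        N-matched : Matched N
        N-matched u with matched-at {E = N′} N′-matched (inj₁ u)
        ... | inj₁ v , e = v , N-old e , unique
          where
          unique : ∀ {w} → N ⟨ u , w ⟩ → v ≡ w
          unique {w} f with N⁻ f
          ... | inj₁ e′ = inj₁-injective (unique′ {inj₁ u} {inj₁ v} {inj₁ w} e e′)
          ... | inj₂ (_ , r) with () ← unique′ {inj₁ u} {inj₁ v} {inj₂ u} e r
        ... | inj₂ v , e with refl ← same⁻ {u = u} {v} (G′-edge (inj₁ u) (inj₂ v) e) = mate u , N-new (mate-edge u) e , unique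
          where
          unique : ∀ {w} → N ⟨ u , w ⟩ → mate u ≡ w
          unique {w} f with N⁻ f
          ... | inj₁ e′ with () ← unique′ {inj₁ u} {inj₂ u} {inj₁ w} e e′
          ... | inj₂ (m , _) = mate-unique m

      -- For uv in `F` the edge u′v′ has been deleted, so u′ can only be matched to u; the rung at u
      -- then puts uv into `N`.
      F⊆N : F ⊆ N
      F⊆N u v f with matched-at {E = N′} N′-matched (inj₂ u)
      ... | inj₁ w , e with refl ← same⁻ {u = u} {w} (G′-edge (inj₂ u) (inj₁ w) e) = N-new (F⊆M u v f) (symmetric N′ e)
      ... | inj₂ w , e with refl ← partner-unique {M = M} (proj₂ perfect) (G′-edge (inj₂ u) (inj₂ w) e) (F⊆M u v f) =
        ⊥-elim (proj₂ (∖⁻ G′ A (proj₁ perfect′ _ _ e)) (double⁺ {A = ∅} {const false} {F} (inj₂ u) (inj₂ v) f))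

      N≐M : N ≐ M
      N≐M = proj₂ forcing N N-perfect F⊆N

      -- Edges of `N′` between original vertices lie in `G ∖ M`, so an edge of `M` can have entered
      -- `N` only through its rungs.
      all-rungs : ∀ u → T (rung u)
      all-rungs u with N⁻ {u} (subst T (sym (N≐M u (mate u))) (mate-edge u))
      ... | inj₁ e = ⊥-elim (proj₂ (∖⁻ G M (G′-edge (inj₁ u) (inj₁ (mate u)) e)) (mate-edge u))
      ... | inj₂ (_ , r) = r

      N′≐M′ : N′ ≐ M′
      N′≐M′ = matched-⊆⇒≐ {M = M′} {N′} M′-matched N′-matched
        (⊆-by-vertex {E = M′} {N′} λ s t r → subst (λ z → N′ ⟨ vertex s , vertex z ⟩) (rungs⁻ s t r) (lemma s))
        where
        lemma : ∀ s → N′ ⟨ vertex s , vertex (swap s) ⟩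
        lemma (inj₁ u) = all-rungs u
        lemma (inj₂ u) = symmetric N′ (all-rungs u)

    anti-forcing : AntiForcingSet G′ M′ A
    anti-forcing = A⊆ , M′-perfect-A , N′≐M′

  -- From anti-forcing sets to forcing sets

  module Backward (A : EdgeSet (n + n)) (anti : AntiForcingSet G′ M′ A) where

    -- The bound `toℕ u < toℕ x` makes a deleted edge hit only one of its ends. Rungs produce no
    -- charge, since `A` avoids `M′`.
    Hit : Fin n → Set
    Hit u = (Σ[ x ∈ Fin n ] toℕ u < toℕ x × A ⟨ vertex (inj₁ u) , vertex (inj₁ x) ⟩)
          ⊎ A ⟨ vertex (inj₂ u) , vertex (inj₂ (mate u)) ⟩

    hit? : ∀ u → Dec (Hit u)
    hit? u = any? (λ x → (toℕ u <? toℕ x) ×-dec T? (adj A (vertex (inj₁ u)) (vertex (inj₁ x)))) ⊎-dec T? (adj A (vertex (inj₂ u)) (vertex (inj₂ (mate u))))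

    -- A hit at either end selects the matching edge, which makes the relation symmetric;
    -- decidability turns it into a Boolean adjacency.
    F? : ∀ u v → Dec (M ⟨ u , v ⟩ × (Hit u ⊎ Hit v))
    F? u v = T? (adj M u v) ×-dec (hit? u ⊎-dec hit? v)

    F : EdgeSet n
    adj        F u v = ⌊ F? u v ⌋
    adj-sym    F u v = T-ext (flip u v) (flip v u)
      where
      flip : ∀ u v → T ⌊ F? u v ⌋ → T ⌊ F? v u ⌋
      flip u v f = let (m , h) = toWitness f in fromWitness (symmetric M m , swap h)
    adj-irrefl F u   = T-ext (λ f → irreflexive M (proj₁ (toWitness {a? = F? u u} f))) (λ ())

    F⊆M : F ⊆ M
    F⊆M u v f = proj₁ (toWitness {a? = F? u v} f)

    hit⇒F : ∀ {u} → Hit u → F ⟨ u , mate u ⟩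
    hit⇒F {u} h = fromWitness {a? = F? u (mate u)} (mate-edge u , inj₁ h)

    ordered : Fin n → Fin n → Fin n × Fin n
    ordered u v with <-cmp (toℕ u) (toℕ v)
    ... | tri> _ _ _ = v , u
    ... | _          = u , v

    ordered-< : ∀ {u v} → toℕ u < toℕ v → ordered u v ≡ (u , v)
    ordered-< {u} {v} u<v with <-cmp (toℕ u) (toℕ v)
    ... | tri< _ _ _ = refl
    ... | tri≈ _ _ _ = refl
    ... | tri> _ _ v<u = ⊥-elim (<-asym u<v v<u)

    ordered-> : ∀ {u v} → toℕ u < toℕ v → ordered v u ≡ (u , v)
    ordered-> {u} {v} u<v with <-cmp (toℕ v) (toℕ u)
    ... | tri< v<u _ _ = ⊥-elim (<-asym u<v v<u)
    ... | tri≈ _ eq _ = cong₂ _,_ (toℕ-injective eq) (toℕ-injective (sym eq))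
    ... | tri> _ _ _ = refl

    base : Fin (n + n) → Fin n
    base p = [ id , id ]′ (splitAt n p)

    -- The second end can be ignored. In a counted pair of original vertices the first is the
    -- smaller one, and two copies joined by an edge of `G′` have bases matched to each other.
    -- `ordered` returns the matching edge in the orientation in which `size` counts it.
    charge : Fin (n + n) × Fin (n + n) → Fin n × Fin n
    charge (p , _) = ordered (base p) (mate (base p))

    -- The edge must be listed from its smaller end. For an edge between copies that may be the copy
    -- of `u` or of `mate u`, hence the disjunction; both determine the same matching edge.
    hit-edge : ∀ {u} → Hit u → ∃₂ λ p q → toℕ p < toℕ q × A ⟨ p , q ⟩ × (base p ≡ u ⊎ base p ≡ mate u)
    hit-edge {u} (inj₁ (x , u<x , a)) =
      vertex (inj₁ u) , vertex (inj₁ x) ,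
      subst₂ _<_ (sym (toℕ-↑ˡ u n)) (sym (toℕ-↑ˡ x n)) u<x , a ,
      inj₁ (cong [ id , id ]′ (splitAt-join n n (inj₁ u)))
    hit-edge {u} (inj₂ a) with <-cmp (toℕ (vertex (inj₂ u))) (toℕ (vertex (inj₂ (mate u))))
    ... | tri< lt _ _ = _ , _ , lt , a , inj₁ (cong [ id , id ]′ (splitAt-join n n (inj₂ u)))
    ... | tri> _ _ gt = _ , _ , gt , symmetric A a , inj₂ (cong [ id , id ]′ (splitAt-join n n (inj₂ (mate u))))
    ... | tri≈ _ eq _ = ⊥-elim (irreflexive A (subst (λ z → A ⟨ vertex (inj₂ u) , z ⟩) (sym (toℕ-injective eq)) a))

    size-F : size F ≤ size A
    size-F = size-≤ F A charge λ u v u<v f →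
      let (m , h) = toWitness {a? = F? u v} f
          v≡ = mate-unique m
          u≡ = mate-unique (symmetric M m)
          forth : ∀ w → w ≡ u → ordered w (mate w) ≡ (u , v)
          forth w w≡u = trans (cong (λ z → ordered z (mate z)) w≡u) (trans (cong (ordered u) v≡) (ordered-< u<v))
          back : ∀ w → w ≡ v → ordered w (mate w) ≡ (u , v)
          back w w≡v = trans (cong (λ z → ordered z (mate z)) w≡v) (trans (cong (ordered v) u≡) (ordered-> u<v))
      -- The hit may be at either end of uv, and the deleted edge may be listed from that end or
      -- from its mate; all four combinations are charged to the pair `(u , v)`.
      in [ (λ h → let (p , q , p<q , a , c) = hit-edge h in
              p , q , p<q , a , [ forth (base p) , (λ eq → back (base p) (trans eq v≡)) ]′ c)
         , (λ h → let (p , q , p<q , a , c) = hit-edge h in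
              p , q , p<q , a , [ back (base p) , (λ eq → forth (base p) (trans eq u≡)) ]′ c)
         ]′ h

    module _ (N : EdgeSet n) (N-perfect : PerfectMatching G N) (F⊆N : F ⊆ N) where

      N-matched = proj₂ N-perfect

      rung : Fin n → Bool
      rung u = adj N u (mate u)

      -- The lift of `N`, inverse to the contraction used in the other direction: u′ and v′ are
      -- matched to each other exactly when uv in `M` is missing from `N`.
      N′ : EdgeSet (n + n)
      N′ = double (N ∖ M) rung (M ∖ N)

      hit-edge-in-M : ∀ {u v} → Hit u → N ⟨ u , v ⟩ → M ⟨ u , v ⟩
      hit-edge-in-M {u} h e =
        subst (λ z → M ⟨ u , z ⟩) (partner-unique {M = N} N-matched (F⊆N _ _ (hit⇒F h)) e) (mate-edge u)

      -- A deleted edge hits a vertex whose matching edge is then in `F`, hence in `N`. An original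
      -- edge of `N ∖ M` would give that vertex a second partner in `N`, and an edge between copies
      -- would come from an edge outside `N`.
      avoids : ∀ s t → T (adj⊎ (N ∖ M) rung (M ∖ N) s t) → (G′ ∖ A) ⟨ vertex s , vertex t ⟩
      avoids (inj₁ u) (inj₁ v) e =
        ∖⁺ G′ A (double⁺ {A = G ∖ M} {B = M} (inj₁ u) (inj₁ v) (∖⁺ G M (proj₁ N-perfect u v Nuv) ¬Muv)) ¬a
        where
        Nuv = proj₁ (∖⁻ N M {u} {v} e)
        ¬Muv = proj₂ (∖⁻ N M {u} {v} e)
        ¬a : ¬ A ⟨ vertex (inj₁ u) , vertex (inj₁ v) ⟩
        ¬a a with <-cmp (toℕ u) (toℕ v)
        ... | tri< u<v _ _ = ¬Muv (hit-edge-in-M (inj₁ (v , u<v , a)) Nuv)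
        ... | tri≈ _ eq _ = irreflexive N (subst (λ z → N ⟨ u , z ⟩) (sym (toℕ-injective eq)) Nuv)
        ... | tri> _ _ v<u = ¬Muv (symmetric M (hit-edge-in-M (inj₁ (u , v<u , symmetric A a)) (symmetric N Nuv)))
      -- No rung is deleted, because `M′` itself is a perfect matching of `G′ ∖ A`.
      avoids (inj₁ u) (inj₂ v) e with refl ← same⁻ {u = u} {v} (proj₂ (∧⁻ {rung u} e)) =
        proj₁ (proj₁ (proj₂ anti)) _ _ (rungs⁺ (inj₁ u))
      avoids (inj₂ u) (inj₁ v) e with refl ← same⁻ {u = u} {v} (proj₂ (∧⁻ {rung u} e)) =
        proj₁ (proj₁ (proj₂ anti)) _ _ (rungs⁺ (inj₂ u))
      avoids (inj₂ u) (inj₂ v) e with (Muv , ¬Nuv) ← ∖⁻ M N {u} {v} e with refl ← mate-unique Muv =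
        ∖⁺ G′ A (double⁺ {A = G ∖ M} {B = M} (inj₂ u) (inj₂ v) Muv) (λ a → ¬Nuv (F⊆N u v (hit⇒F (inj₂ a))))

      N′⁺ : ∀ s t → T (adj⊎ (N ∖ M) rung (M ∖ N) s t) → N′ ⟨ vertex s , vertex t ⟩
      N′⁺ = double⁺ {A = N ∖ M} {rung} {M ∖ N}

      N′-matched : Matched N′
      N′-matched = matched-by-vertex {E = N′} λ s →
        let (t , e , unique) = partner s in t , N′⁺ s t e , λ t′ e′ → unique t′ (double⁻ {A = N ∖ M} {rung} {M ∖ N} s t′ e′)
        where
        partner : ∀ s → ∃[ t ] T (adj⊎ (N ∖ M) rung (M ∖ N) s t) × (∀ t′ → T (adj⊎ (N ∖ M) rung (M ∖ N) s t′) → t ≡ t′)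
        partner (inj₁ u) with T? (rung u)
        ... | yes r = inj₂ u , ∧⁺ r (same⁺ u) , λ where
          (inj₁ w) e → let (Nuw , ¬Muw) = ∖⁻ N M {u} {w} e in
            ⊥-elim (¬Muw (subst (λ z → M ⟨ u , z ⟩) (partner-unique {M = N} N-matched r Nuw) (mate-edge u)))
          (inj₂ w) e → cong inj₂ (same⁻ (proj₂ (∧⁻ {rung u} e)))
        ... | no ¬r = let (v , Nuv , unique) = N-matched u in
          inj₁ v , ∖⁺ N M Nuv (λ m → ¬r (subst (λ z → N ⟨ u , z ⟩) (sym (mate-unique m)) Nuv)) , λ where
            (inj₁ w) e → cong inj₁ (unique (proj₁ (∖⁻ N M {u} {w} e)))
            (inj₂ w) e → ⊥-elim (¬r (proj₁ (∧⁻ {rung u} e)))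
        partner (inj₂ u) with T? (rung u)
        ... | yes r = inj₁ u , ∧⁺ r (same⁺ u) , λ where
          (inj₁ w) e → cong inj₁ (same⁻ (proj₂ (∧⁻ {rung u} e)))
          (inj₂ w) e → let (Muw , ¬Nuw) = ∖⁻ M N {u} {w} e in
            ⊥-elim (¬Nuw (subst (λ z → N ⟨ u , z ⟩) (mate-unique Muw) r))
        ... | no ¬r = inj₂ (mate u) , ∖⁺ M N (mate-edge u) ¬r , λ where
            (inj₁ w) e → ⊥-elim (¬r (proj₁ (∧⁻ {rung u} e)))
            (inj₂ w) e → cong inj₂ (mate-unique (proj₁ (∖⁻ M N {u} {w} e)))

      N′-perfect : PerfectMatching (G′ ∖ A) N′
      N′-perfect =
        ⊆-by-vertex {E = N′} {G′ ∖ A} (λ s t e → avoids s t (double⁻ {A = N ∖ M} {rung} {M ∖ N} s t e)) , N′-matched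

      -- Anti-forcing makes the lift equal to `M′`, so every rung is present in it; by construction
      -- of the lift, the rung at u is present only if `N` joins u to its mate.
      N≐M : N ≐ M
      N≐M = matched-⊆⇒≐ {M = M} {N} (proj₂ perfect) N-matched λ u v m →
        subst (λ z → N ⟨ u , z ⟩) (mate-unique m)
          (proj₁ (∧⁻ {rung u} (double⁻ {A = N ∖ M} {rung} {M ∖ N} (inj₁ u) (inj₂ u)
            (subst T (sym (proj₂ (proj₂ anti) N′ N′-perfect _ _)) (rungs⁺ (inj₁ u))))))

    forcing : ForcingSet G M F
    forcing = F⊆M , N≐M

  equivalent : ∀ k →
    (∃[ F ] ForcingSet G M F × size F ≤ k) ⇔ (∃[ A ] AntiForcingSet G′ M′ A × size A ≤ k)
  equivalent k = mk⇔
    (λ (F , f , le) → let open Forward F f in A , anti-forcing , ≤-trans size-A le)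
    (λ (A , a , le) → let open Backward A a in F , forcing , ≤-trans size-F le)

-- The Turing machine

Sym : Set
Sym = Maybe Bool

Phase : Set
Phase = Fin 5

-- The tapes are, in this order, the input, the output, the ruler and the
-- store.  The ruler has n cells and holds the unit vector of the current row;
-- the store holds a copy of G and later of M.  Each of the five phases (copying
-- G, then the four n × 2n half matrices of the output) makes two sweeps over
-- the ruler per row.  In fwd p h c and back p h c, the flag h selects the second
-- sweep and c is the bit carried while that sweep shifts the ruler by one.
State : Set
State = Fin 5 ⊎ Phase × (Bool ⊎ Bool × Bool × Bool)

pattern header       = inj₁ 0F
pattern mirror       = inj₁ 1F
pattern copyTail     = inj₁ 2F
pattern rewindO      = inj₁ 3F
pattern halted       = inj₁ 4F
pattern mark p       = inj₂ (p , inj₁ false)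
pattern rewindX p    = inj₂ (p , inj₁ true)
pattern fwd p h c    = inj₂ (p , inj₂ (false , h , c))
pattern back p h c   = inj₂ (p , inj₂ (true , h , c))

State↔Fin : State ↔ Fin (5 + 5 * (2 + 2 * (2 * 2)))
State↔Fin =
  ↔-sym (+↔⊎ {5}) ↔-∘ (↔-id _ ⊎-↔
    (↔-sym (*↔× {5}) ↔-∘ (↔-id _ ×-↔
      (↔-sym (+↔⊎ {2}) ↔-∘ (↔-sym 2↔Bool ⊎-↔
        (↔-sym (*↔× {2}) ↔-∘ (↔-sym 2↔Bool ×-↔
          (↔-sym (*↔× {2}) ↔-∘ (↔-sym 2↔Bool ×-↔ ↔-sym 2↔Bool)))))))))

Sym↔Fin : Sym ↔ Fin 3
Sym↔Fin = mk↔ₛ′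
  (λ { nothing → 0F ; (just false) → 1F ; (just true) → 2F })
  (λ { 0F → nothing ; 1F → just false ; 2F → just true })
  (λ { 0F → refl ; 1F → refl ; 2F → refl })
  (λ { nothing → refl ; (just false) → refl ; (just true) → refl })

data Kind : Set where
  copyIn skip diff marker fromX zeroX : Kind

-- Phases 1 to 4 write the half matrices [G∖M | I], [I | M], [0 | I] and [I | 0], one sweep for each
-- half of a row. The idle `skip` lets phase 0 share the sweep that shifts the ruler. `zeroX` moves
-- the store head although it copies nothing, so that every phase leaves it at the end of the store,
-- where the next rewind starts.
kind : Phase → Bool → Kind
kind 0F false = copyIn
kind 0F true  = skip
kind 1F false = diff
kind 1F true  = marker
kind 2F false = marker
kind 2F true  = fromX
kind 3F false = zeroX
kind 3F true  = marker
kind 4F false = marker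
kind 4F true  = zeroX

next-phase : Phase → State
next-phase 0F = mark 1F
next-phase 1F = mark 2F
next-phase 2F = mark 3F
next-phase 3F = mark 4F
next-phase 4F = copyTail

bitOf : Sym → Bool
bitOf = fromMaybe false

-- The action of one sweep step on input, output and store.  The kind diff
-- replaces the entries of G in the store by those of M for the later phases.
cell : Kind → Sym → Bool → Sym → (Sym × Move) × (Sym × Move) × (Sym × Move)
cell copyIn i w x = (i , R) , (nothing , S) , (i , R)
cell skip   i w x = (i , S) , (nothing , S) , (x , S)
cell diff   i w x = (i , R) , (just (bitOf x ∧ not (bitOf i)) , R) , (i , R)
cell marker i w x = (i , S) , (just w , R) , (x , S)
cell fromX  i w x = (i , S) , (x , R) , (x , R)
cell zeroX  i w x = (i , S) , (just false , R) , (x , R)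

written : Bool → Bool → Bool → Bool
written rotate c w = if rotate then c else w

carry : Bool → Bool → Bool → Bool
carry rotate c w = if rotate then w else c

-- The bit carried out of the shift is the 1 of the unit vector exactly after the last row. The
-- ruler is then all zero and ready to be marked again.
after : Phase → Bool → Bool → State
after p false c     = fwd p true false
after p true  false = fwd p false false
after p true  true  = next-phase p

Action : Set
Action = Maybe (State × Vec (Sym × Move) 4)

-- Reading the unary prefix both emits n ones and lays out the n ruler cells; walking back along
-- these cells in `mirror` emits the other n ones of the doubled vertex count.
δ-header : Sym → Sym → Sym → Sym → Action
δ-header (just true)  o w x = just (header , (just true , R) ∷ (just true , R) ∷ (just false , R) ∷ (x , S) ∷ [])
δ-header (just false) o w x = just (mirror , (just false , R) ∷ (o , S) ∷ (w , L) ∷ (x , S) ∷ [])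
δ-header nothing      o w x = nothing

δ-mirror : Sym → Sym → Sym → Sym → Action
δ-mirror i o (just w) x = just (mirror , (i , S) ∷ (just true , R) ∷ (just w , L) ∷ (x , S) ∷ [])
δ-mirror i o nothing  x = just (mark 0F , (i , S) ∷ (just false , R) ∷ (nothing , R) ∷ (x , S) ∷ [])

-- A blank under the ruler head means n = 0.
δ-mark : Phase → Sym → Sym → Sym → Sym → Action
δ-mark p i o (just _) x = just (rewindX p , (i , S) ∷ (o , S) ∷ (just true , S) ∷ (x , L) ∷ [])
δ-mark p i o nothing  x = just (copyTail , (i , S) ∷ (o , S) ∷ (nothing , S) ∷ (x , S) ∷ [])

δ-rewindX : Phase → Sym → Sym → Sym → Sym → Action
δ-rewindX p i o w (just x) = just (rewindX p , (i , S) ∷ (o , S) ∷ (w , S) ∷ (just x , L) ∷ [])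
δ-rewindX p i o w nothing  = just (fwd p false false , (i , S) ∷ (o , S) ∷ (w , S) ∷ (nothing , R) ∷ [])

δ-fwd : Phase → Bool → Bool → Sym → Sym → Sym → Sym → Action
δ-fwd p h c i o (just w) x =
  let (ai , ao , ax) = cell (kind p h) i w x in
  just (fwd p h (carry h c w) , ai ∷ ao ∷ (just (written h c w) , R) ∷ ax ∷ [])
δ-fwd p h c i o nothing  x = just (back p h c , (i , S) ∷ (o , S) ∷ (nothing , L) ∷ (x , S) ∷ [])

δ-back : Phase → Bool → Bool → Sym → Sym → Sym → Sym → Action
δ-back p h c i o (just w) x = just (back p h c , (i , S) ∷ (o , S) ∷ (just w , L) ∷ (x , S) ∷ [])
δ-back p h c i o nothing  x = just (after p h c , (i , S) ∷ (o , S) ∷ (nothing , R) ∷ (x , S) ∷ [])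

-- Phases 0 and 1 have consumed both matrices (empty when n = 0), so only the numeral of `k`
-- remains, and it is kept.
δ-copyTail : Sym → Sym → Sym → Sym → Action
δ-copyTail (just b) o w x = just (copyTail , (just b , R) ∷ (just b , R) ∷ (w , S) ∷ (x , S) ∷ [])
δ-copyTail nothing  o w x = just (rewindO , (nothing , S) ∷ (o , L) ∷ (w , S) ∷ (x , S) ∷ [])

δ-rewindO : Sym → Sym → Sym → Sym → Action
δ-rewindO i (just o) w x = just (rewindO , (i , S) ∷ (just o , L) ∷ (w , S) ∷ (x , S) ∷ [])
δ-rewindO i nothing  w x = just (halted , (i , S) ∷ (nothing , R) ∷ (w , S) ∷ (x , S) ∷ [])

transition : State → Vec Sym 4 → Action
transition header       (i ∷ o ∷ w ∷ x ∷ []) = δ-header i o w x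
transition mirror       (i ∷ o ∷ w ∷ x ∷ []) = δ-mirror i o w x
transition copyTail     (i ∷ o ∷ w ∷ x ∷ []) = δ-copyTail i o w x
transition rewindO      (i ∷ o ∷ w ∷ x ∷ []) = δ-rewindO i o w x
transition halted       _                    = nothing
transition (mark p)     (i ∷ o ∷ w ∷ x ∷ []) = δ-mark p i o w x
transition (rewindX p)  (i ∷ o ∷ w ∷ x ∷ []) = δ-rewindX p i o w x
transition (fwd p h c)  (i ∷ o ∷ w ∷ x ∷ []) = δ-fwd p h c i o w x
transition (back p h c) (i ∷ o ∷ w ∷ x ∷ []) = δ-back p h c i o w x

machine : TM
machine = record
  { tapes         = 4
  ; State         = State
  ; Symbol        = Sym
  ; finite-State  = _ , State↔Fin
  ; finite-Symbol = _ , Sym↔Fin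
  ; blank         = nothing
  ; bit           = just
  ; bit-injective = λ { refl → refl }
  ; bit≢blank     = λ _ ()
  ; start         = header
  ; inTape        = 0F
  ; outTape       = 1F
  ; δ             = transition
  }

-- Runs of single loops

open Run machine

SymTape : Set
SymTape = Tape Sym

Data : Set
Data = SymTape × SymTape × SymTape

infix 5 _,_⊢_

_,_⊢_ : State → Data → SymTape → Config
q , (i , o , x) ⊢ w = q , i ∷ o ∷ w ∷ x ∷ []

-- at ls rs has ls (nearest first) before the head and rs from the head on;
-- atLeft ls rs has its head on the first cell of ls.
at : List Sym → List Sym → SymTape
at ls []       = tape ls nothing []
at ls (a ∷ rs) = tape ls a rs

atLeft : List Sym → List Sym → SymTape
atLeft []       rs = tape [] nothing rs
atLeft (l ∷ ls) rs = tape ls l rs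

moveR : ∀ ls a rs → move R (tape ls a rs) ≡ at (a ∷ ls) rs
moveR ls a []       = refl
moveR ls a (r ∷ rs) = refl

moveL : ∀ ls a rs → move L (tape ls a rs) ≡ atLeft ls (a ∷ rs)
moveL []       a rs = refl
moveL (l ∷ ls) a rs = refl

cells : List Bool → List Sym
cells = map just

-- Runs are composed in continuation-passing style: from a halting run of the
-- later configuration one gets a halting run of the earlier one.
rewind-loop : ∀ q q′ (put : SymTape → Vec SymTape 4) →
  (∀ b ls rs → step (q , put (tape ls (just b) rs)) ≡ just (q , put (move L (tape ls (just b) rs)))) →
  (∀ rs → step (q , put (tape [] nothing rs)) ≡ just (q′ , put (move R (tape [] nothing rs)))) →
  ∀ pad → (∀ rs → atLeft pad rs ≡ tape [] nothing rs) →
  ∀ ys rs {t e} →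
  (q′ , put (at (nothing ∷ []) (cells ys ʳ++ rs))) ⇓[ t ] e →
  (q , put (atLeft (cells ys ++ pad) rs)) ⇓[ suc (length ys + t) ] e
rewind-loop q q′ put stepL stepR pad padding [] rs k rewrite padding rs =
  next (trans (stepR rs) (cong (λ t → just (q′ , put t)) (moveR [] nothing rs))) k
rewind-loop q q′ put stepL stepR pad padding (y ∷ ys) rs k =
  next (trans (stepL y (cells ys ++ pad) rs)
              (cong (λ t → just (q , put t)) (moveL (cells ys ++ pad) (just y) rs)))
       (rewind-loop q q′ put stepL stepR pad padding ys (just y ∷ rs) k)

cells-reverse : ∀ xs pad → cells (reverse xs) ++ pad ≡ cells xs ʳ++ pad
cells-reverse xs pad = trans (cong (_++ pad) (reverse-map just xs)) (sym (ʳ++-defn (cells xs)))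

cells-unreverse : ∀ xs rs → cells (reverse xs) ʳ++ rs ≡ cells xs ++ rs
cells-unreverse xs rs = trans (cong (_ʳ++ rs) (reverse-map just xs)) (ʳ++-ʳ++ (cells xs))

-- `put` selects the tape being rewound: ruler, store or output. `pad` is empty if the blank left of
-- the data has not been visited and one explicit blank if it has; the head sees no difference.
rewind : ∀ q q′ (put : SymTape → Vec SymTape 4) →
  (∀ b ls rs → step (q , put (tape ls (just b) rs)) ≡ just (q , put (move L (tape ls (just b) rs)))) →
  (∀ rs → step (q , put (tape [] nothing rs)) ≡ just (q′ , put (move R (tape [] nothing rs)))) →
  ∀ pad → (∀ rs → atLeft pad rs ≡ tape [] nothing rs) →
  ∀ xs rs {t e} →
  (q′ , put (at (nothing ∷ []) (cells xs ++ rs))) ⇓[ t ] e →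
  (q , put (atLeft (cells xs ʳ++ pad) rs)) ⇓[ suc (length xs + t) ] e
rewind q q′ put stepL stepR pad padding xs rs {t} {e} k =
  subst₂ (λ ls n → (q , put (atLeft ls rs)) ⇓[ suc (n + t) ] e)
    (cells-reverse xs pad) (length-reverse xs)
    (rewind-loop q q′ put stepL stepR pad padding (reverse xs) rs
      (subst (λ z → (q′ , put (at (nothing ∷ []) z)) ⇓[ t ] e) (sym (cells-unreverse xs rs)) k))

cellStep : Kind → Bool → Data → Data
cellStep κ w (i , o , x) =
  let (ai , ao , ax) = cell κ (Tape.head i) w (Tape.head x) in
  act ai i , act ao o , act ax x

sweep : Kind → List Bool → Data → Data
sweep κ []       d = d
sweep κ (w ∷ ws) d = sweep κ ws (cellStep κ w d)

writtens : Bool → Bool → List Bool → List Bool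
writtens h c []       = []
writtens h c (w ∷ ws) = written h c w ∷ writtens h (carry h c w) ws

carries : Bool → Bool → List Bool → Bool
carries h c []       = c
carries h c (w ∷ ws) = carries h (carry h c w) ws

fwd-loop : ∀ p h c ws ls d {t e} →
  (back p h (carries h c ws) , sweep (kind p h) ws d ⊢ atLeft (cells (writtens h c ws) ʳ++ ls) (nothing ∷ [])) ⇓[ t ] e →
  (fwd p h c , d ⊢ at ls (cells ws ++ nothing ∷ [])) ⇓[ suc (length ws + t) ] e
fwd-loop p h c [] ls d k =
  next (cong (λ z → just (back p h c , d ⊢ z)) (moveL ls nothing [])) k
fwd-loop p h c (w ∷ ws) ls d k =
  next (cong (λ z → just (fwd p h (carry h c w) , cellStep (kind p h) w d ⊢ z))
             (moveR ls (just (written h c w)) (cells ws ++ nothing ∷ [])))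
       (fwd-loop p h (carry h c w) ws (just (written h c w) ∷ ls) (cellStep (kind p h) w d) k)

-- The explicit blanks are the cells where the head turns. Recording them makes a sweep return a
-- tape of literally the same form, since tapes are not identified up to surrounding blanks.
ruler : List Bool → SymTape
ruler ws = at (nothing ∷ []) (cells ws ++ nothing ∷ [])

length-writtens : ∀ h c ws → length (writtens h c ws) ≡ length ws
length-writtens h c []       = refl
length-writtens h c (w ∷ ws) = cong suc (length-writtens h (carry h c w) ws)

half-row : ∀ p h c ws d {t e} →
  (after p h (carries h c ws) , sweep (kind p h) ws d ⊢ ruler (writtens h c ws)) ⇓[ t ] e →
  (fwd p h c , d ⊢ ruler ws) ⇓[ suc (length ws + suc (length ws + t)) ] e
half-row p h c ws d@(i , o , x) {t} {e} k =
  fwd-loop p h c ws (nothing ∷ []) d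
    (subst (λ n → (back p h (carries h c ws) , sweep (kind p h) ws d ⊢ atLeft (cells (writtens h c ws) ʳ++ nothing ∷ []) (nothing ∷ [])) ⇓[ suc (n + t) ] e)
      (length-writtens h c ws)
      (rewind (back p h _) (after p h _)
        (λ w → let (i′ , o′ , x′) = sweep (kind p h) ws d in i′ ∷ o′ ∷ w ∷ x′ ∷ [])
        (λ _ _ _ → refl) (λ _ → refl) (nothing ∷ []) (λ _ → refl)
        (writtens h c ws) (nothing ∷ []) k))

writtens-keep : ∀ c ws → writtens false c ws ≡ ws
writtens-keep c []       = refl
writtens-keep c (w ∷ ws) = cong (w ∷_) (writtens-keep c ws)

row : Phase → List Bool → Data → Data
row p ws d = sweep (kind p true) ws (sweep (kind p false) ws d)

row-run : ∀ p ws d {t e} →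
  (after p true (carries true false ws) , row p ws d ⊢ ruler (writtens true false ws)) ⇓[ t ] e →
  (fwd p false false , d ⊢ ruler ws)
    ⇓[ suc (length ws + suc (length ws + suc (length ws + suc (length ws + t)))) ] e
row-run p ws d {t} {e} k =
  half-row p false false ws d
    (subst (λ z → (fwd p true false , sweep (kind p false) ws d ⊢ ruler z)
                    ⇓[ suc (length ws + suc (length ws + t)) ] e)
      (sym (writtens-keep false ws))
      (half-row p true false ws (sweep (kind p false) ws d) k))

-- The ruler as a travelling unit vector

unit : ℕ → ℕ → List Bool
unit u v = replicate u false ++ true ∷ replicate v false

units : ℕ → ℕ → List (List Bool)
units u zero    = unit u 0 ∷ []
units u (suc v) = unit u (suc v) ∷ units (suc u) v

zeros : ℕ → List Bool
zeros n = replicate n false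

shift-zeros : ∀ v → writtens true false (zeros v) ≡ zeros v
shift-zeros zero    = refl
shift-zeros (suc v) = cong (false ∷_) (shift-zeros v)

shift-unit : ∀ u v → writtens true false (unit u (suc v)) ≡ unit (suc u) v
shift-unit zero    v = cong (λ z → false ∷ true ∷ z) (shift-zeros v)
shift-unit (suc u) v = cong (false ∷_) (shift-unit u v)

shift-last : ∀ u → writtens true false (unit u 0) ≡ zeros (suc u)
shift-last zero    = refl
shift-last (suc u) = cong (false ∷_) (shift-last u)

carries-zeros : ∀ v → carries true false (zeros v) ≡ false
carries-zeros zero    = refl
carries-zeros (suc v) = carries-zeros v

carries-unit : ∀ u v → carries true false (unit u (suc v)) ≡ false
carries-unit zero    v = carries-zeros v
carries-unit (suc u) v = carries-unit u v

carries-last : ∀ u → carries true false (unit u 0) ≡ true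
carries-last zero    = refl
carries-last (suc u) = carries-last u

length-unit : ∀ u v → length (unit u v) ≡ u + suc v
length-unit zero    v = cong suc (length-replicate v)
length-unit (suc u) v = cong suc (length-unit u v)

block : Phase → List (List Bool) → Data → Data
block p []        d = d
block p (ws ∷ us) d = block p us (row p ws d)

row-time : ℕ → ℕ → ℕ
row-time n t = suc (n + suc (n + suc (n + suc (n + t))))

rows-time : ℕ → ℕ → ℕ → ℕ
rows-time zero    n t = t
rows-time (suc r) n t = row-time n (rows-time r n t)

-- Induction on the number `v` of cells beyond the 1. The row itself runs alike for every `v`; only
-- `continue` distinguishes whether the shift keeps the 1, giving another row, or loses it, ending
-- the phase.
block-run : ∀ p n u v → u + suc v ≡ n → ∀ d {t e} →
  (next-phase p , block p (units u v) d ⊢ ruler (zeros n)) ⇓[ t ] e →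
  (fwd p false false , d ⊢ ruler (unit u v)) ⇓[ rows-time (suc v) n t ] e
block-run p n u v eq d {t} {e} k =
  subst (λ m → (fwd p false false , d ⊢ ruler (unit u v)) ⇓[ row-time m (rows-time v n t) ] e)
    (trans (length-unit u v) eq)
    (row-run p (unit u v) d (continue v eq k))
  where
  continue : ∀ v → u + suc v ≡ n →
    (next-phase p , block p (units u v) d ⊢ ruler (zeros n)) ⇓[ t ] e →
    (after p true (carries true false (unit u v)) , row p (unit u v) d ⊢ ruler (writtens true false (unit u v)))
      ⇓[ rows-time v n t ] e
  continue zero eq k
    rewrite carries-last u | shift-last u | sym (trans (sym (+-comm u 1)) eq) = k
  continue (suc v) eq k
    rewrite carries-unit u v | shift-unit u v =
    block-run p n (suc u) v (trans (sym (+-suc u (suc v))) eq) (row p (unit u (suc v)) d) k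

-- The effect of the phase enters as an equation, which separates the control flow, common to all
-- phases, from what each of them computes.
phase-run : ∀ p m pad → (∀ rs → atLeft pad rs ≡ tape [] nothing rs) →
  ∀ i o xs {d t e} → block p (units 0 m) (i , o , ruler xs) ≡ d →
  (next-phase p , d ⊢ ruler (zeros (suc m))) ⇓[ t ] e →
  (mark p , (i , o , tape (cells xs ʳ++ pad) nothing []) ⊢ ruler (zeros (suc m)))
    ⇓[ suc (suc (length xs + rows-time (suc m) (suc m) t)) ] e
phase-run p m pad padding i o xs refl k =
  next (cong (λ x → just (rewindX p , (i , o , x) ⊢ ruler (unit 0 m)))
             (moveL (cells xs ʳ++ pad) nothing []))
    (rewind (rewindX p) (fwd p false false) (λ x → i ∷ o ∷ ruler (unit 0 m) ∷ x ∷ [])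
      (λ _ _ _ → refl) (λ _ → refl) pad padding xs (nothing ∷ [])
      (block-run p (suc m) 0 m refl (i , o , ruler xs) k))

header-run : ∀ n rest il ol wl x {t e} →
  (mirror , (at (just false ∷ cells (replicate n true) ʳ++ il) rest , tape (cells (replicate n true) ʳ++ ol) nothing [] , x)
     ⊢ atLeft (cells (zeros n) ʳ++ wl) (nothing ∷ [])) ⇓[ t ] e →
  (header , (at il (cells (replicate n true) ++ just false ∷ rest) , tape ol nothing [] , x)
     ⊢ tape wl nothing []) ⇓[ suc (n + t) ] e
header-run zero rest il ol wl x k =
  next (cong₂ (λ i w → just (mirror , (i , tape ol nothing [] , x) ⊢ w))
         (moveR il (just false) rest) (moveL wl nothing [])) k
header-run (suc n) rest il ol wl x k =
  next (cong (λ i → just (header , (i , tape (just true ∷ ol) nothing [] , x) ⊢ tape (just false ∷ wl) nothing []))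
         (moveR il (just true) (cells (replicate n true) ++ just false ∷ rest)))
    (header-run n rest (just true ∷ il) (just true ∷ ol) (just false ∷ wl) x k)

mirror-run : ∀ n i ol rs x {t e} →
  (mark 0F , (i , tape (just false ∷ cells (replicate n true) ʳ++ ol) nothing [] , x)
     ⊢ at (nothing ∷ []) (cells (zeros n) ʳ++ rs)) ⇓[ t ] e →
  (mirror , (i , tape ol nothing [] , x) ⊢ atLeft (cells (zeros n)) rs) ⇓[ suc (n + t) ] e
mirror-run zero i ol rs x k =
  next (cong (λ w → just (mark 0F , (i , tape (just false ∷ ol) nothing [] , x) ⊢ w)) (moveR [] nothing rs)) k
mirror-run (suc n) i ol rs x k =
  next (cong (λ w → just (mirror , (i , tape (just true ∷ ol) nothing [] , x) ⊢ w))
         (moveL (cells (zeros n)) (just false) rs))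
    (mirror-run n i (just true ∷ ol) (just false ∷ rs) x k)

tail-run : ∀ bs il ol w x {t e} →
  (rewindO , (at (cells bs ʳ++ il) [] , atLeft (cells bs ʳ++ ol) (nothing ∷ []) , x) ⊢ w) ⇓[ t ] e →
  (copyTail , (at il (cells bs) , tape ol nothing [] , x) ⊢ w) ⇓[ suc (length bs + t) ] e
tail-run [] il ol w x k =
  next (cong (λ o → just (rewindO , (tape il nothing [] , o , x) ⊢ w)) (moveL ol nothing [])) k
tail-run (b ∷ bs) il ol w x k =
  next (cong (λ i → just (copyTail , (i , tape (just b ∷ ol) nothing [] , x) ⊢ w)) (moveR il (just b) (cells bs)))
    (tail-run bs (just b ∷ il) (just b ∷ ol) w x k)

matrix : ∀ {I J : Set} → (I → J → Bool) → List I → List J → List Bool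
matrix f is js = map (uncurry f) (cartesianProduct is js)

matrix-∷ : ∀ {I J : Set} (f : I → J → Bool) i is js →
  matrix f (i ∷ is) js ≡ map (f i) js ++ matrix f is js
matrix-∷ f i is js =
  trans (map-++ (uncurry f) (map (i ,_) js) (cartesianProduct is js))
        (cong (_++ matrix f is js) (sym (map-∘ js)))

outT : List Sym → SymTape
outT ol = tape ol nothing []

-- What the sweeps compute

module _ {J : Set} where

  -- In these lemmas ruler, input and store rows are maps over a common list of columns, so one
  -- induction advances all heads together. An arbitrary list is needed because the tail of
  -- `allFin n` is no longer of that form.
  sweep-copyIn : ∀ (e g : J → Bool) js il ir ol xl →
    sweep copyIn (map e js) (at il (cells (map g js) ++ ir) , outT ol , outT xl) ≡
      (at (cells (map g js) ʳ++ il) ir , outT ol , outT (cells (map g js) ʳ++ xl))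
  sweep-copyIn e g []       il ir ol xl = refl
  sweep-copyIn e g (j ∷ js) il ir ol xl
    rewrite moveR il (just (g j)) (cells (map g js) ++ ir) =
    sweep-copyIn e g js (just (g j) ∷ il) ir ol (just (g j) ∷ xl)

  sweep-skip : ∀ (e : J → Bool) js i ol x →
    sweep skip (map e js) (i , outT ol , x) ≡ (i , outT ol , x)
  sweep-skip e []       i ol x = refl
  sweep-skip e (j ∷ js) i ol x = sweep-skip e js i ol x

  sweep-diff : ∀ (e m g : J → Bool) js il ir ol xl xr →
    sweep diff (map e js) (at il (cells (map m js) ++ ir) , outT ol , at xl (cells (map g js) ++ xr)) ≡
      (at (cells (map m js) ʳ++ il) ir
      , outT (cells (map (λ j → g j ∧ not (m j)) js) ʳ++ ol)
      , at (cells (map m js) ʳ++ xl) xr)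
  sweep-diff e m g []       il ir ol xl xr = refl
  sweep-diff e m g (j ∷ js) il ir ol xl xr
    rewrite moveR il (just (m j)) (cells (map m js) ++ ir)
          | moveR xl (just (m j)) (cells (map g js) ++ xr) =
    sweep-diff e m g js (just (m j) ∷ il) ir (just (g j ∧ not (m j)) ∷ ol) (just (m j) ∷ xl) xr

  sweep-marker : ∀ (e : J → Bool) js i ol x →
    sweep marker (map e js) (i , outT ol , x) ≡ (i , outT (cells (map e js) ʳ++ ol) , x)
  sweep-marker e []       i ol x = refl
  sweep-marker e (j ∷ js) i ol x = sweep-marker e js i (just (e j) ∷ ol) x

  sweep-fromX : ∀ (e m : J → Bool) js i ol xl xr →
    sweep fromX (map e js) (i , outT ol , at xl (cells (map m js) ++ xr)) ≡
      (i , outT (cells (map m js) ʳ++ ol) , at (cells (map m js) ʳ++ xl) xr)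
  sweep-fromX e m []       i ol xl xr = refl
  sweep-fromX e m (j ∷ js) i ol xl xr
    rewrite moveR xl (just (m j)) (cells (map m js) ++ xr) =
    sweep-fromX e m js i (just (m j) ∷ ol) (just (m j) ∷ xl) xr

  sweep-zeroX : ∀ (e m : J → Bool) js i ol xl xr →
    sweep zeroX (map e js) (i , outT ol , at xl (cells (map m js) ++ xr)) ≡
      (i , outT (cells (map (const false) js) ʳ++ ol) , at (cells (map m js) ʳ++ xl) xr)
  sweep-zeroX e m []       i ol xl xr = refl
  sweep-zeroX e m (j ∷ js) i ol xl xr
    rewrite moveR xl (just (m j)) (cells (map m js) ++ xr) =
    sweep-zeroX e m js i (just false ∷ ol) (just (m j) ∷ xl) xr

-- Half matrices and whole phases

rows : ∀ {I J : Set} → (f g : I → J → Bool) → List I → List J → List Bool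
rows f g []       js = []
rows f g (i ∷ is) js = map (f i) js ++ map (g i) js ++ rows f g is js

cells-++ : ∀ xs ys rs → cells (xs ++ ys) ++ rs ≡ cells xs ++ (cells ys ++ rs)
cells-++ xs ys rs = trans (cong (_++ rs) (map-++ just xs ys)) (++-assoc (cells xs) (cells ys) rs)

cells-++-ʳ++ : ∀ xs ys ls → cells (xs ++ ys) ʳ++ ls ≡ cells ys ʳ++ (cells xs ʳ++ ls)
cells-++-ʳ++ xs ys ls = trans (cong (_ʳ++ ls) (map-++ just xs ys)) (++-ʳ++ (cells xs))

matrix-forward : ∀ {I J : Set} (f : I → J → Bool) i is js rs →
  cells (matrix f (i ∷ is) js) ++ rs ≡ cells (map (f i) js) ++ (cells (matrix f is js) ++ rs)
matrix-forward f i is js rs =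
  trans (cong (λ z → cells z ++ rs) (matrix-∷ f i is js)) (cells-++ (map (f i) js) (matrix f is js) rs)

matrix-backward : ∀ {I J : Set} (f : I → J → Bool) i is js ls →
  cells (matrix f (i ∷ is) js) ʳ++ ls ≡ cells (matrix f is js) ʳ++ (cells (map (f i) js) ʳ++ ls)
matrix-backward f i is js ls =
  trans (cong (λ z → cells z ʳ++ ls) (matrix-∷ f i is js)) (cells-++-ʳ++ (map (f i) js) (matrix f is js) ls)

rows-backward : ∀ {I J : Set} (f g : I → J → Bool) i is js ls →
  cells (rows f g (i ∷ is) js) ʳ++ ls ≡
    cells (rows f g is js) ʳ++ (cells (map (g i) js) ʳ++ (cells (map (f i) js) ʳ++ ls))
rows-backward f g i is js ls =
  trans (cells-++-ʳ++ (map (f i) js) (map (g i) js ++ rows f g is js) ls)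
        (cells-++-ʳ++ (map (g i) js) (rows f g is js) (cells (map (f i) js) ʳ++ ls))

module _ {I J : Set} (e : I → J → Bool) (js : List J) where

  rulers : List I → List (List Bool)
  rulers = map (λ i → map (e i) js)

  block-0 : ∀ (g : I → J → Bool) is il ir ol xl →
    block 0F (rulers is) (at il (cells (matrix g is js) ++ ir) , outT ol , outT xl) ≡
      (at (cells (matrix g is js) ʳ++ il) ir , outT ol , outT (cells (matrix g is js) ʳ++ xl))
  block-0 g []       il ir ol xl = refl
  block-0 g (i ∷ is) il ir ol xl
    rewrite matrix-forward g i is js ir
          | sweep-copyIn (e i) (g i) js il (cells (matrix g is js) ++ ir) ol xl
          | sweep-skip (e i) js (at (cells (map (g i) js) ʳ++ il) (cells (matrix g is js) ++ ir)) ol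
              (outT (cells (map (g i) js) ʳ++ xl))
          | matrix-backward g i is js il
          | matrix-backward g i is js xl =
    block-0 g is (cells (map (g i) js) ʳ++ il) ir ol (cells (map (g i) js) ʳ++ xl)

  block-1 : ∀ (m g : I → J → Bool) is il ir ol xl xr →
    block 1F (rulers is) (at il (cells (matrix m is js) ++ ir) , outT ol , at xl (cells (matrix g is js) ++ xr)) ≡
      (at (cells (matrix m is js) ʳ++ il) ir
      , outT (cells (rows (λ i j → g i j ∧ not (m i j)) e is js) ʳ++ ol)
      , at (cells (matrix m is js) ʳ++ xl) xr)
  block-1 m g []       il ir ol xl xr = refl
  block-1 m g (i ∷ is) il ir ol xl xr
    rewrite matrix-forward m i is js ir
          | matrix-forward g i is js xr
          | sweep-diff (e i) (m i) (g i) js il (cells (matrix m is js) ++ ir) ol xl (cells (matrix g is js) ++ xr)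
          | sweep-marker (e i) js (at (cells (map (m i) js) ʳ++ il) (cells (matrix m is js) ++ ir))
              (cells (map (λ j → g i j ∧ not (m i j)) js) ʳ++ ol)
              (at (cells (map (m i) js) ʳ++ xl) (cells (matrix g is js) ++ xr))
          | matrix-backward m i is js il
          | matrix-backward m i is js xl
          | rows-backward (λ i j → g i j ∧ not (m i j)) e i is js ol =
    block-1 m g is (cells (map (m i) js) ʳ++ il) ir _ (cells (map (m i) js) ʳ++ xl) xr

  block-2 : ∀ (m : I → J → Bool) is i₀ ol xl xr →
    block 2F (rulers is) (i₀ , outT ol , at xl (cells (matrix m is js) ++ xr)) ≡
      (i₀ , outT (cells (rows e m is js) ʳ++ ol) , at (cells (matrix m is js) ʳ++ xl) xr)
  block-2 m []       i₀ ol xl xr = refl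
  block-2 m (i ∷ is) i₀ ol xl xr
    rewrite matrix-forward m i is js xr
          | sweep-marker (e i) js i₀ ol (at xl (cells (map (m i) js) ++ (cells (matrix m is js) ++ xr)))
          | sweep-fromX (e i) (m i) js i₀ (cells (map (e i) js) ʳ++ ol) xl (cells (matrix m is js) ++ xr)
          | matrix-backward m i is js xl
          | rows-backward e m i is js ol =
    block-2 m is i₀ _ (cells (map (m i) js) ʳ++ xl) xr

  block-3 : ∀ (m : I → J → Bool) is i₀ ol xl xr →
    block 3F (rulers is) (i₀ , outT ol , at xl (cells (matrix m is js) ++ xr)) ≡
      (i₀ , outT (cells (rows (λ _ _ → false) e is js) ʳ++ ol) , at (cells (matrix m is js) ʳ++ xl) xr)
  block-3 m []       i₀ ol xl xr = refl
  block-3 m (i ∷ is) i₀ ol xl xr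
    rewrite matrix-forward m i is js xr
          | sweep-zeroX (e i) (m i) js i₀ ol xl (cells (matrix m is js) ++ xr)
          | sweep-marker (e i) js i₀ (cells (map (const false) js) ʳ++ ol)
              (at (cells (map (m i) js) ʳ++ xl) (cells (matrix m is js) ++ xr))
          | matrix-backward m i is js xl
          | rows-backward (λ _ _ → false) e i is js ol =
    block-3 m is i₀ _ (cells (map (m i) js) ʳ++ xl) xr

  block-4 : ∀ (m : I → J → Bool) is i₀ ol xl xr →
    block 4F (rulers is) (i₀ , outT ol , at xl (cells (matrix m is js) ++ xr)) ≡
      (i₀ , outT (cells (rows e (λ _ _ → false) is js) ʳ++ ol) , at (cells (matrix m is js) ʳ++ xl) xr)
  block-4 m []       i₀ ol xl xr = refl
  block-4 m (i ∷ is) i₀ ol xl xr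
    rewrite matrix-forward m i is js xr
          | sweep-marker (e i) js i₀ ol (at xl (cells (map (m i) js) ++ (cells (matrix m is js) ++ xr)))
          | sweep-zeroX (e i) (m i) js i₀ (cells (map (e i) js) ʳ++ ol) xl (cells (matrix m is js) ++ xr)
          | matrix-backward m i is js xl
          | rows-backward e (λ _ _ → false) i is js ol =
    block-4 m is i₀ _ (cells (map (m i) js) ʳ++ xl) xr

units-suc : ∀ u v → units (suc u) v ≡ map (false ∷_) (units u v)
units-suc u zero    = refl
units-suc u (suc v) = cong ((false ∷ unit u (suc v)) ∷_) (units-suc (suc u) v)

allFin-suc : ∀ n → allFin (suc n) ≡ zero ∷ map suc (allFin n)
allFin-suc n = cong (zero ∷_) (sym (map-tabulate (λ i → i) suc))

map-false : ∀ {J : Set} (js : List J) → map (const false) js ≡ zeros (length js)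
map-false []       = refl
map-false (j ∷ js) = cong (false ∷_) (map-false js)

rulers-suc : ∀ {m n} (is js : List (Fin m)) → length js ≡ n →
  rulers same (zero ∷ map suc js) (zero ∷ map suc is) ≡ unit 0 n ∷ map (false ∷_) (rulers same js is)
rulers-suc is js refl = cong₂ _∷_
  (cong (true ∷_) (trans (sym (map-∘ js)) (map-false js)))
  (trans (sym (map-∘ is))
    (trans (map-cong (λ i → cong (false ∷_) (sym (map-∘ js))) is) (map-∘ is)))

-- This identifies the successive ruler contents with the identity matrix: removing its first row
-- and first column leaves a smaller identity matrix.
units-rulers : ∀ m → units 0 m ≡ rulers same (allFin (suc m)) (allFin (suc m))
units-rulers zero    = refl
units-rulers (suc m) =
  trans (cong (unit 0 (suc m) ∷_) (trans (units-suc 0 m) (cong (map (false ∷_)) (units-rulers m))))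
        (sym (trans (cong₂ (rulers same) (allFin-suc (suc m)) (allFin-suc (suc m)))
                    (rulers-suc (allFin (suc m)) (allFin (suc m)) (length-tabulate (λ i → i)))))

-- The complete run and its output

at-++ : ∀ ls xs a → ∃[ j ] Tape.head (at ls (cells xs ++ a ∷ [])) ∷ Tape.right (at ls (cells xs ++ a ∷ [])) ≡ cells xs ++ replicate j a
at-++ ls []       a = 1 , refl
at-++ ls (x ∷ xs) a = 1 , refl

load-at : ∀ w → load w ≡ at [] (cells w)
load-at []       = refl
load-at (b ∷ bs) = refl

replicate-ʳ++ : ∀ {A : Set} n (a : A) rs → replicate n a ʳ++ (a ∷ rs) ≡ a ∷ (replicate n a ʳ++ rs)
replicate-ʳ++ zero    a rs = refl
replicate-ʳ++ (suc n) a rs = replicate-ʳ++ n a (a ∷ rs)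

zeros-ʳ++ : ∀ n rs → cells (zeros n) ʳ++ rs ≡ cells (zeros n) ++ rs
zeros-ʳ++ zero    rs = refl
zeros-ʳ++ (suc n) rs =
  trans (cong (λ z → z ʳ++ (just false ∷ rs)) (map-replicate just n false))
  (trans (replicate-ʳ++ n (just false) rs)
  (cong (just false ∷_)
    (trans (cong (_ʳ++ rs) (sym (map-replicate just n false))) (zeros-ʳ++ n rs))))

finish : ∀ bs out {ol} il w x → cells bs ʳ++ ol ≡ cells out ʳ++ [] →
  ∃[ e ] ((copyTail , (at il (cells bs) , outT ol , x) ⊢ w) ⇓[ suc (length bs + suc (length out + 0)) ] e)
    × Outputs e out
finish bs out {ol} il w x eq =
  _ ,
  tail-run bs il ol w x
    (subst (λ z → (rewindO , (i , atLeft z (nothing ∷ []) , x) ⊢ w) ⇓[ suc (length out + 0) ] final) (sym eq)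
      (rewind rewindO halted (λ o → i ∷ o ∷ w ∷ x ∷ []) (λ _ _ _ → refl) (λ _ → refl)
        [] (λ _ → refl) out (nothing ∷ []) (halt refl))) ,
  left-blank out , at-++ (nothing ∷ []) out nothing
  where
  i = at (cells bs ʳ++ il) []
  final = halted , (i , ruler out , x) ⊢ w
  left-blank : ∀ xs → ∃[ j ] Tape.left (ruler xs) ≡ replicate j nothing
  left-blank []       = 1 , refl
  left-blank (x ∷ xs) = 1 , refl

phase-time : ℕ → ℕ → ℕ → ℕ
phase-time n a t = suc (suc (a + rows-time n n t))

-- The first phase rewinds an empty store, the other four a store of `a` entries. For n = 0 the
-- single step is the jump past all phases.
phases-time : ℕ → ℕ → ℕ → ℕ
phases-time zero    a t = suc t
phases-time n@(suc _) a t =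
  phase-time n 0 (phase-time n a (phase-time n a (phase-time n a (phase-time n a t))))

module Codes {n : ℕ} (g m : Fin n → Fin n → Bool) (bs : List Bool) where

  js : List (Fin n)
  js = allFin n

  A B : List Bool
  A = matrix g js js
  B = matrix m js js

  input : List Bool
  input = replicate n true ++ false ∷ A ++ B ++ bs

  b₁ b₂ b₃ b₄ : List Bool
  b₁ = rows (λ i j → g i j ∧ not (m i j)) same js js
  b₂ = rows same m js js
  b₃ = rows (λ _ _ → false) same js js
  b₄ = rows same (λ _ _ → false) js js

  output : List Bool
  output = replicate n true ++ replicate n true ++ false ∷ b₁ ++ b₂ ++ b₃ ++ b₄ ++ bs

  il ol₀ ol₁ ol₂ ol₃ ol₄ : List Sym
  il = just false ∷ cells (replicate n true) ʳ++ []
  ol₀ = just false ∷ cells (replicate n true) ʳ++ (cells (replicate n true) ʳ++ [])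
  ol₁ = cells b₁ ʳ++ ol₀
  ol₂ = cells b₂ ʳ++ ol₁
  ol₃ = cells b₃ ʳ++ ol₂
  ol₄ = cells b₄ ʳ++ ol₃

  ol≡output : cells bs ʳ++ ol₄ ≡ cells output ʳ++ []
  ol≡output = sym (
    trans (cells-++-ʳ++ (replicate n true) _ [])
    (trans (cells-++-ʳ++ (replicate n true) _ _)
    (trans (cells-++-ʳ++ b₁ _ ol₀)
    (trans (cells-++-ʳ++ b₂ _ ol₁)
    (trans (cells-++-ʳ++ b₃ _ ol₂)
    (cells-++-ʳ++ b₄ bs ol₃))))))

tail-time : List Bool → List Bool → ℕ
tail-time bs out = suc (length bs + suc (length out + 0))

phases-run : ∀ {n} (g m : Fin n → Fin n → Bool) bs a → let open Codes g m bs in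
  length A ≡ a → length B ≡ a →
  ∃[ e ] ((mark 0F , (at il (cells A ++ (cells B ++ cells bs)) , outT ol₀ , tape [] nothing []) ⊢ ruler (zeros n))
            ⇓[ phases-time n a (tail-time bs output) ] e)
    × Outputs e output
phases-run {zero} g m bs a _ _ =
  let (e , k , out) = finish bs output il _ _ ol≡output in e , next refl k , out
  where open Codes g m bs
phases-run {suc n} g m bs a refl lenB =
  let (e , k , out) = finish bs output il₂ _ _ ol≡output
      4-eq = trans (cong (λ us → block 4F us (i₂ , outT ol₃ , ruler B)) (units-rulers n))
                   (block-4 same js m js i₂ ol₃ (nothing ∷ []) (nothing ∷ []))
      3-eq = trans (cong (λ us → block 3F us (i₂ , outT ol₂ , ruler B)) (units-rulers n))
                   (block-3 same js m js i₂ ol₂ (nothing ∷ []) (nothing ∷ []))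
      2-eq = trans (cong (λ us → block 2F us (i₂ , outT ol₁ , ruler B)) (units-rulers n))
                   (block-2 same js m js i₂ ol₁ (nothing ∷ []) (nothing ∷ []))
      1-eq = trans (cong (λ us → block 1F us (i₁ , outT ol₀ , ruler A)) (units-rulers n))
                   (block-1 same js m g js il₁ (cells bs) ol₀ (nothing ∷ []) (nothing ∷ []))
      0-eq = trans (cong (λ us → block 0F us (i₀ , outT ol₀ , ruler [])) (units-rulers n))
                   (block-0 same js g js il (cells B ++ cells bs) ol₀ (nothing ∷ []))
      -- Matching on `refl` has replaced `a` by `length A`, while the store now holds `B`; the time
      -- bound is transported along the equality of the two lengths.
      with-length-B = λ p o t (k : (mark p , (i₂ , o , xB) ⊢ W) ⇓[ phase-time (suc n) (length B) t ] e) →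
                subst (λ b → (mark p , (i₂ , o , xB) ⊢ W) ⇓[ phase-time (suc n) b t ] e) lenB k
  in e ,
     phase-run 0F n [] (λ _ → refl) i₀ (outT ol₀) [] 0-eq
     (phase-run 1F n (nothing ∷ []) (λ _ → refl) i₁ (outT ol₀) A 1-eq
     (with-length-B 2F (outT ol₁) _ (phase-run 2F n (nothing ∷ []) (λ _ → refl) i₂ (outT ol₁) B 2-eq
     (with-length-B 3F (outT ol₂) _ (phase-run 3F n (nothing ∷ []) (λ _ → refl) i₂ (outT ol₂) B 3-eq
     (with-length-B 4F (outT ol₃) _ (phase-run 4F n (nothing ∷ []) (λ _ → refl) i₂ (outT ol₃) B 4-eq k))))))) ,
     out
  where
  open Codes g m bs
  il₁ = cells A ʳ++ il
  il₂ = cells B ʳ++ il₁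
  i₀ = at il (cells A ++ (cells B ++ cells bs))
  i₁ = at il₁ (cells B ++ cells bs)
  i₂ = at il₂ (cells bs)
  W  = ruler (zeros (suc n))
  xB = tape (cells B ʳ++ nothing ∷ []) nothing []

-- Codes and running time

allFin-+ : ∀ m n → allFin (m + n) ≡ map (_↑ˡ n) (allFin m) ++ map (m ↑ʳ_) (allFin n)
allFin-+ zero    n = sym (map-id (allFin n))
allFin-+ (suc m) n = begin
  allFin (suc m + n)                                                          ≡⟨ allFin-suc (m + n) ⟩
  zero ∷ map suc (allFin (m + n))                                             ≡⟨ cong (λ z → zero ∷ map suc z) (allFin-+ m n) ⟩
  zero ∷ map suc (map (_↑ˡ n) (allFin m) ++ map (m ↑ʳ_) (allFin n))           ≡⟨ cong (zero ∷_) (map-++ suc (map (_↑ˡ n) (allFin m)) _) ⟩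
  zero ∷ map suc (map (_↑ˡ n) (allFin m)) ++ map suc (map (m ↑ʳ_) (allFin n)) ≡⟨ cong₂ (λ x y → zero ∷ x ++ y)
                                                                                   (trans (sym (map-∘ (allFin m))) (map-∘ (allFin m)))
                                                                                   (sym (map-∘ (allFin n))) ⟩
  zero ∷ map (_↑ˡ n) (map suc (allFin m)) ++ map (suc m ↑ʳ_) (allFin n)       ≡⟨ cong (λ z → map (_↑ˡ n) z ++ map (suc m ↑ʳ_) (allFin n)) (allFin-suc m) ⟨
  map (_↑ˡ n) (allFin (suc m)) ++ map (suc m ↑ʳ_) (allFin n)                  ∎
  where open ≡-Reasoning

matrix-++ : ∀ {I J : Set} (F : I → J → Bool) is is′ js → matrix F (is ++ is′) js ≡ matrix F is js ++ matrix F is′ js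
matrix-++ F is is′ js =
  trans (cong (map (uncurry F)) (cartesianProductWith-distribʳ-++ _,_ is is′ js))
        (map-++ (uncurry F) (cartesianProduct is js) (cartesianProduct is′ js))

matrix-blocks : ∀ {I₀ I J₀ J : Set} (F : I → J → Bool) (f : I₀ → I) (l r : J₀ → J) {A B : I₀ → J₀ → Bool} →
  (∀ i j → F (f i) (l j) ≡ A i j) → (∀ i j → F (f i) (r j) ≡ B i j) →
  ∀ is js → matrix F (map f is) (map l js ++ map r js) ≡ rows A B is js
matrix-blocks F f l r eqA eqB []       js = refl
matrix-blocks F f l r {A} {B} eqA eqB (i ∷ is) js = begin
  matrix F (f i ∷ map f is) (map l js ++ map r js)
    ≡⟨ matrix-∷ F (f i) (map f is) (map l js ++ map r js) ⟩
  map (F (f i)) (map l js ++ map r js) ++ matrix F (map f is) (map l js ++ map r js)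
    ≡⟨ cong₂ _++_ (map-++ (F (f i)) (map l js) (map r js)) (matrix-blocks F f l r eqA eqB is js) ⟩
  (map (F (f i)) (map l js) ++ map (F (f i)) (map r js)) ++ rows A B is js
    ≡⟨ cong₂ (λ x y → (x ++ y) ++ rows A B is js)
         (trans (sym (map-∘ js)) (map-cong (eqA i) js)) (trans (sym (map-∘ js)) (map-cong (eqB i) js)) ⟩
  (map (A i) js ++ map (B i) js) ++ rows A B is js
    ≡⟨ ++-assoc (map (A i) js) (map (B i) js) _ ⟩
  rows A B (i ∷ is) js ∎
  where open ≡-Reasoning

matrix-double : ∀ {n} (A : EdgeSet n) d B {C D} → (∀ u v → d u ∧ same u v ≡ D u v) → (∀ u v → adj B u v ≡ C u v) →
  map (uncurry (adj (double A d B))) (pairs (n + n)) ≡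
    rows (adj A) D (allFin n) (allFin n) ++ rows D C (allFin n) (allFin n)
matrix-double {n} A d B {C} {D} eqD eqC = begin
  matrix F (allFin (n + n)) (allFin (n + n))
    ≡⟨ cong₂ (matrix F) (allFin-+ n n) (allFin-+ n n) ⟩
  matrix F (ls ++ rs) (ls ++ rs)
    ≡⟨ matrix-++ F ls rs (ls ++ rs) ⟩
  matrix F ls (ls ++ rs) ++ matrix F rs (ls ++ rs)
    ≡⟨ cong₂ _++_
         (matrix-blocks F (_↑ˡ n) (_↑ˡ n) (n ↑ʳ_)
           (λ u v → adj-double {A = A} {d} {B} (inj₁ u) (inj₁ v))
           (λ u v → trans (adj-double {A = A} {d} {B} (inj₁ u) (inj₂ v)) (eqD u v)) (allFin n) (allFin n))
         (matrix-blocks F (n ↑ʳ_) (_↑ˡ n) (n ↑ʳ_)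
           (λ u v → trans (adj-double {A = A} {d} {B} (inj₂ u) (inj₁ v)) (eqD u v))
           (λ u v → trans (adj-double {A = A} {d} {B} (inj₂ u) (inj₂ v)) (eqC u v)) (allFin n) (allFin n)) ⟩
  rows (adj A) D (allFin n) (allFin n) ++ rows D C (allFin n) (allFin n) ∎
  where
  open ≡-Reasoning
  F = adj (double A d B)
  ls = map (_↑ˡ n) (allFin n)
  rs = map (n ↑ʳ_) (allFin n)

reduce : MatchingInstance → MatchingInstance
reduce I = record
  { G       = G′
  ; M       = M′
  ; perfect = M′-perfect
  ; k       = k
  }
  where
  open MatchingInstance I
  open Reduction G M perfect

module Encoding (I : MatchingInstance) where
  open MatchingInstance I
  open Codes (adj G) (adj M) (bits (fromℕ k)) public
  open Reduction G M perfect

  output≡encode : output ≡ encodeInstance (reduce I)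
  output≡encode = sym (begin
    replicate (n + n) true ++ false ∷ matrix (adj G′) (allFin (n + n)) (allFin (n + n))
      ++ matrix (adj M′) (allFin (n + n)) (allFin (n + n)) ++ bits (fromℕ k)
      ≡⟨ cong₂ _++_ (replicate-+ n)
           (cong₂ (λ x y → false ∷ x ++ y ++ bits (fromℕ k))
             (matrix-double (G ∖ M) (λ _ → true) M {adj M} {same} (λ _ _ → refl) (λ _ _ → refl))
             (matrix-double {n} ∅ (λ _ → true) ∅ {λ _ _ → false} {same} (λ _ _ → refl) (λ _ _ → refl))) ⟩
    (replicate n true ++ replicate n true) ++ false ∷ (b₁ ++ b₂) ++ (b₃ ++ b₄) ++ bits (fromℕ k)
      ≡⟨ ++-assoc (replicate n true) (replicate n true) _ ⟩
    replicate n true ++ replicate n true ++ false ∷ (b₁ ++ b₂) ++ (b₃ ++ b₄) ++ bits (fromℕ k)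
      ≡⟨ cong (λ z → replicate n true ++ replicate n true ++ false ∷ z)
           (trans (++-assoc b₁ b₂ _) (cong (λ z → b₁ ++ b₂ ++ z) (++-assoc b₃ b₄ _))) ⟩
    output ∎)
    where
    open ≡-Reasoning
    replicate-+ : ∀ m → replicate (m + n) true ≡ replicate m true ++ replicate n true
    replicate-+ zero    = refl
    replicate-+ (suc m) = cong (true ∷_) (replicate-+ m)

length-pairs : ∀ n → length (pairs n) ≡ n * n
length-pairs n = trans (go (allFin n)) (cong (λ z → z * z) (length-tabulate {n = n} (λ i → i)))
  where
  go : ∀ (is : List (Fin n)) → length (cartesianProduct is (allFin n)) ≡ length is * length (allFin n)
  go []       = refl
  go (i ∷ is) = trans (length-++ (map (i ,_) (allFin n))) (cong₂ _+_ (length-map (i ,_) (allFin n)) (go is))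

length-matrix : ∀ {n} (E : EdgeSet n) → length (map (uncurry (adj E)) (pairs n)) ≡ n * n
length-matrix {n} E = trans (length-map _ (pairs n)) (length-pairs n)

code-length : ℕ → ℕ → ℕ
code-length n b = n + suc (n * n + (n * n + b))

length-encode : ∀ I → let open MatchingInstance I in
  length (encodeInstance I) ≡ code-length n (length (bits (fromℕ k)))
length-encode I =
  trans (length-++ (replicate n true))
  (cong₂ (λ x y → x + suc y) (length-replicate n)
  (trans (length-++ A) (cong₂ _+_ (length-matrix G)
  (trans (length-++ B) (cong (_+ length bs) (length-matrix M))))))
  where
  open MatchingInstance I
  open Codes (adj G) (adj M) (bits (fromℕ k))
  bs = bits (fromℕ k)

machine-run : ∀ {n} (g m : Fin n → Fin n → Bool) bs a → let open Codes g m bs in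
  length A ≡ a → length B ≡ a →
  ∃[ e ] (initial input ⇓[ suc (n + suc (n + phases-time n a (tail-time bs output))) ] e) × Outputs e output
machine-run {n} g m bs a lenA lenB = e , run , out
  where
  open Codes g m bs
  rest = cells A ++ (cells B ++ cells bs)
  T₀ = phases-time n a (tail-time bs output)
  x₀ = tape [] nothing []
  result = phases-run g m bs a lenA lenB
  e = proj₁ result
  out = proj₂ (proj₂ result)

  input-at : load input ≡ at [] (cells (replicate n true) ++ just false ∷ rest)
  input-at = trans (load-at input) (cong (at [])
    (trans (map-++ just (replicate n true) _)
    (cong (λ z → cells (replicate n true) ++ just false ∷ z)
    (trans (map-++ just A _) (cong (cells A ++_) (map-++ just B bs))))))

  run : initial input ⇓[ suc (n + suc (n + T₀)) ] e
  run = subst (λ i → (header , (i , outT [] , x₀) ⊢ tape [] nothing []) ⇓[ suc (n + suc (n + T₀)) ] e) (sym input-at)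
    (header-run n rest [] [] [] x₀
    (subst (λ z → (mirror , (at il rest , outT (cells (replicate n true) ʳ++ []) , x₀) ⊢ atLeft z (nothing ∷ [])) ⇓[ suc (n + T₀) ] e)
      (sym (trans (zeros-ʳ++ n []) (++-identityʳ (cells (zeros n)))))
    (mirror-run n (at il rest) (cells (replicate n true) ʳ++ []) (nothing ∷ []) x₀
    (subst (λ z → (mark 0F , (at il rest , outT ol₀ , x₀) ⊢ at (nothing ∷ []) z) ⇓[ T₀ ] e)
      (sym (zeros-ʳ++ n (nothing ∷ [])))
      (proj₁ (proj₂ result))))))

-- A row takes two sweeps, each going out and back over n cells with one extra step at every turn,
-- hence 4n + 4 steps.
rows-time-linear : ∀ r n t → rows-time r n t ≡ r * (4 * n + 4) + t
rows-time-linear zero    n t = refl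
rows-time-linear (suc r) n t = trans (cong (row-time n) (rows-time-linear r n t)) (collect (r * (4 * n + 4)) n t)
  where
  collect : ∀ z n t → suc (n + suc (n + suc (n + suc (n + (z + t))))) ≡ 4 * n + 4 + z + t
  collect = solve-∀

phase-time-linear : ∀ n a t → phase-time n a t ≡ 2 + a + n * (4 * n + 4) + t
phase-time-linear n a t = cong (2 +_)
  (trans (cong (a +_) (rows-time-linear n n t)) (sym (+-assoc a (n * (4 * n + 4)) t)))

phases-time-linear : ∀ m a t → let n = suc m in
  phases-time n a t ≡ 10 + 4 * a + 5 * (n * (4 * n + 4)) + t
phases-time-linear m a t =
  trans (next-phase-time 0 (next-phase-time a (next-phase-time a (next-phase-time a (phase-time-linear n a t)))))
        (collect a (n * (4 * n + 4)) t)
  where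
  n = suc m
  next-phase-time : ∀ a {t u} → t ≡ u → phase-time n a t ≡ 2 + a + n * (4 * n + 4) + u
  next-phase-time a eq = trans (cong (phase-time n a) eq) (phase-time-linear n a _)
  collect : ∀ a z t →
    2 + 0 + z + (2 + a + z + (2 + a + z + (2 + a + z + (2 + a + z + t)))) ≡ 10 + 4 * a + 5 * z + t
  collect = solve-∀

total-time : ℕ → ℕ → ℕ
total-time n b = suc (n + suc (n + phases-time n (n * n) (suc (b + suc (code-length (n + n) b + 0)))))

-- The quadratic part of the time is 20n² for five phases of n rows, 4n² for rewinding the store and
-- 8n² for rewinding the output. The code already contains 2n² matrix bits, so exponent 1 suffices
-- and 32 is a generous factor. The summand added on the left is the exact difference of the two
-- sides.
time-bound : ∀ n b → total-time n b ≤ 32 * code-length n b ^ 1 + 32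
time-bound zero b = ≤-trans (m≤m+n (total-time 0 b) (30 * b + 58)) (≤-reflexive (slack b))
  where
  slack : ∀ b → 2 + suc (suc (b + suc (suc b + 0))) + (30 * b + 58) ≡ 32 * (suc b * 1) + 32
  slack = solve-∀
time-bound n@(suc m) b =
  ≤-trans (m≤m+n (total-time n b) (32 * (n * n) + 8 * n + 30 * b + 49))
    (≤-reflexive (trans (cong (λ z → suc (n + suc (n + z)) + (32 * (n * n) + 8 * n + 30 * b + 49)) (phases-time-linear m (n * n) _))
                        (slack n b)))
  where
  slack : ∀ n b →
    suc (n + suc (n + (10 + 4 * (n * n) + 5 * (n * (4 * n + 4)) +
      suc (b + suc ((n + n + suc ((n + n) * (n + n) + ((n + n) * (n + n) + b))) + 0))))) + (32 * (n * n) + 8 * n + 30 * b + 49)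
    ≡ 32 * ((n + suc (n * n + (n * n + b))) * 1) + 32
  slack = solve-∀

theorem1 : ForcingGPM ≤ₚ Anti-ForcingGPM
theorem1 = reduce , (machine , 32 , 1 , λ I →
    let open MatchingInstance I
        open Encoding I
        b = length (bits (fromℕ k))
        (e , run , out) = machine-run (adj G) (adj M) (bits (fromℕ k)) (n * n) (length-matrix G) (length-matrix M)
    in _ , e , run ,
       subst₂ (λ x y → suc (n + suc (n + phases-time n (n * n) (suc (b + suc (x + 0))))) ≤ 32 * y ^ 1 + 32)
         (sym (trans (cong length output≡encode) (length-encode (reduce I)))) (sym (length-encode I)) (time-bound n b) ,
       subst (Outputs e) output≡encode out) ,
  λ I → let open MatchingInstance I in Reduction.equivalent G M perfect k
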